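{- On chordal graphs, a minimum connected $(s,t)$-vertex separator can be found in polynomial time: there is a polynomial-time algorithm that, given a chordal graph $G$ and a non-adjacent pair $(s,t)$ of vertices of $G$, outputs a minimum connected $(s,t)$-vertex separator of $G$.
   Context: All graphs are finite, connected, undirected, unweighted and simple. A graph is chordal if it contains no induced cycle of length at least 4. For a non-adjacent pair $(s,t)$ of vertices of $G$, an $(s,t)$-vertex separator is a set $S\subset V(G)$ such that $s$ and $t$ lie in two different connected components of $G\setminus S$ (in particular $s,t\notin S$). A connected $(s,t)$-vertex separator is an $(s,t)$-vertex separator $S$ with $G[S]$ connected; it is minimum if it has least size among all connected $(s,t)$-vertex separators. -}

module Defs where

open import Data.Bool.Base using (Bool; true; false)
open import Data.Fin.Base using (Fin; zero; toℕ)
open import Data.Fin.Subset using (Subset; _∈_; _∉_; ∁; ∣_∣)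
open import Data.Nat.Base using (ℕ; zero; suc; _+_; _*_; _^_; _≤_; NonZero)
open import Data.Nat.DivMod using (_%_)
open import Data.Product.Base using (Σ-syntax; ∃-syntax; _×_)
open import Data.Sum.Base using (_⊎_)
open import Data.Vec.Base using (Vec; []; _∷_; lookup; tabulate; replicate; _[_]≔_)
open import Function.Bundles using (_⇔_)
open import Function.Definitions using (Injective)
open import Relation.Binary.Construct.Closure.ReflexiveTransitive using (Star)
open import Relation.Binary.PropositionalEquality using (_≡_; _≢_)
open import Relation.Nullary.Negation using (¬_)

------------------------------------------------------------------------
-- Graphs

record Graph (n : ℕ) : Set where
  field
    adj    : Fin n → Fin n → Bool
    sym    : ∀ u v → adj u v ≡ adj v u
    irrefl : ∀ v → adj v v ≡ false

  Adj : Fin n → Fin n → Set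
  Adj u v = adj u v ≡ true

open Graph public using (adj; Adj)

module _ {n : ℕ} (G : Graph n) where

  Connected : Set
  Connected = ∀ u v → Star (Adj G) u v

  AdjIn : Subset n → Fin n → Fin n → Set
  AdjIn U u v = u ∈ U × v ∈ U × Adj G u v

  -- For u , v ∈ U: u and v lie in the same connected component of G[U].
  -- (Outside U, Star still relates every vertex to itself.)
  ReachableIn : Subset n → Fin n → Fin n → Set
  ReachableIn U = Star (AdjIn U)

  InducesConnected : Subset n → Set
  InducesConnected U = ∀ u v → u ∈ U → v ∈ U → ReachableIn U u v

  IsSeparator : Fin n → Fin n → Subset n → Set
  IsSeparator s t S = s ∉ S × t ∉ S × ¬ ReachableIn (∁ S) s t

  IsConnectedSeparator : Fin n → Fin n → Subset n → Set
  IsConnectedSeparator s t S = IsSeparator s t S × InducesConnected S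

  IsMinimumConnectedSeparator : Fin n → Fin n → Subset n → Set
  IsMinimumConnectedSeparator s t S =
    IsConnectedSeparator s t S ×
    (∀ S′ → IsConnectedSeparator s t S′ → ∣ S ∣ ≤ ∣ S′ ∣)

CycleAdj : (k : ℕ) .{{_ : NonZero k}} → Fin k → Fin k → Set
CycleAdj k i j = toℕ j ≡ suc (toℕ i) % k ⊎ toℕ i ≡ suc (toℕ j) % k

IsInducedCycle : ∀ {n} → Graph n → (k : ℕ) .{{_ : NonZero k}} → (Fin k → Fin n) → Set
IsInducedCycle G k f =
  Injective _≡_ _≡_ f × (∀ i j → Adj G (f i) (f j) ⇔ CycleAdj k i j)

Chordal : ∀ {n} → Graph n → Set
Chordal {n} G = ∀ m (f : Fin (4 + m) → Fin n) → ¬ IsInducedCycle G (4 + m) f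

------------------------------------------------------------------------
-- Model of computation: Jones' WHILE language over binary trees (N. D. Jones,
-- "Computability and Complexity from a Programming Perspective").  Trees are
-- immutable and may be shared in memory, so each operator is charged one unit;
-- polynomial time in this model is polynomial time on Turing machines.

data Tree : Set where
  nil  : Tree
  cons : Tree → Tree → Tree

size : Tree → ℕ
size nil        = 1
size (cons a b) = suc (size a + size b)

hdTree tlTree : Tree → Tree
hdTree nil        = nil
hdTree (cons a b) = a
tlTree nil        = nil
tlTree (cons a b) = b

data Expr (k : ℕ) : Set where
  var   : Fin k → Expr k
  nil   : Expr k
  cons  : Expr k → Expr k → Expr k
  hd tl : Expr k → Expr k

Store : ℕ → Set
Store k = Vec Tree k

eval : ∀ {k} → Expr k → Store k → Tree
eval (var x)      σ = lookup σ x
eval nil          σ = nil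
eval (cons e₁ e₂) σ = cons (eval e₁ σ) (eval e₂ σ)
eval (hd e)       σ = hdTree (eval e σ)
eval (tl e)       σ = tlTree (eval e σ)

cost : ∀ {k} → Expr k → ℕ
cost (var x)      = 1
cost nil          = 1
cost (cons e₁ e₂) = suc (cost e₁ + cost e₂)
cost (hd e)       = suc (cost e)
cost (tl e)       = suc (cost e)

infix  7 _:=_
infixr 6 if_then_else_ while_loop_
infixr 5 _⨾_

data Cmd (k : ℕ) : Set where
  _:=_          : Fin k → Expr k → Cmd k
  _⨾_           : Cmd k → Cmd k → Cmd k
  if_then_else_ : Expr k → Cmd k → Cmd k → Cmd k
  while_loop_     : Expr k → Cmd k → Cmd k

-- Exec c σ t σ′: started in σ, the command c halts in σ′ after t time units.
-- In tests, nil is false and every cons is true.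
data Exec {k : ℕ} : Cmd k → Store k → ℕ → Store k → Set where

  assign : ∀ {x e σ} →
    Exec (x := e) σ (suc (cost e)) (σ [ x ]≔ eval e σ)

  seq : ∀ {c₁ c₂ σ σ₁ σ₂ t₁ t₂} →
    Exec c₁ σ t₁ σ₁ → Exec c₂ σ₁ t₂ σ₂ →
    Exec (c₁ ⨾ c₂) σ (t₁ + t₂) σ₂

  if-true : ∀ {e c₁ c₂ σ σ₁ t a b} →
    eval e σ ≡ cons a b → Exec c₁ σ t σ₁ →
    Exec (if e then c₁ else c₂) σ (suc (cost e) + t) σ₁

  if-false : ∀ {e c₁ c₂ σ σ₁ t} →
    eval e σ ≡ nil → Exec c₂ σ t σ₁ →
    Exec (if e then c₁ else c₂) σ (suc (cost e) + t) σ₁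

  while-true : ∀ {e c σ σ₁ σ₂ t₁ t₂ a b} →
    eval e σ ≡ cons a b → Exec c σ t₁ σ₁ → Exec (while e loop c) σ₁ t₂ σ₂ →
    Exec (while e loop c) σ (suc (cost e) + (t₁ + t₂)) σ₂

  while-false : ∀ {e c σ} →
    eval e σ ≡ nil →
    Exec (while e loop c) σ (suc (cost e)) σ

-- Variable zero holds the input at the start and the output at the end; all
-- other variables are initially nil.
record Program : Set where
  constructor program
  field
    {extraVars} : ℕ
    body        : Cmd (suc extraVars)

HaltsWith : Program → Tree → ℕ → Tree → Set
HaltsWith (program {k} c) input t output =
  ∃[ σ ] Exec c (input ∷ replicate k nil) t σ × lookup σ zero ≡ output

-- A search problem with instances I, candidate solutions O i of each instance
-- i, and correctness relation R.  One program must serve all instances.  As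
-- size is at least 1, c * size ^ k dominates every polynomial in the size for
-- suitable c and k.
PolyTimeSolvable :
  {I : Set} {O : I → Set} →
  (I → Tree) → (∀ i → O i → Tree) → (∀ i → O i → Set) → Set
PolyTimeSolvable {I} {O} encodeIn encodeOut R =
  Σ[ P ∈ Program ] ∃[ c ] ∃[ k ] ((i : I) →
    Σ[ o ∈ O i ] ∃[ t ]
      HaltsWith P (encodeIn i) t (encodeOut i o)
      × t ≤ c * size (encodeIn i) ^ k
      × R i o)

------------------------------------------------------------------------
-- Encodings

encodeVec : ∀ {A : Set} {n} → (A → Tree) → Vec A n → Tree
encodeVec f []       = nil
encodeVec f (x ∷ xs) = cons (f x) (encodeVec f xs)

encodeBool : Bool → Tree
encodeBool false = nil
encodeBool true  = cons nil nil

-- Unary, so that a vertex takes size linear in the number of vertices.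
encodeℕ : ℕ → Tree
encodeℕ zero    = nil
encodeℕ (suc n) = cons nil (encodeℕ n)

encodeFin : ∀ {n} → Fin n → Tree
encodeFin i = encodeℕ (toℕ i)

-- The adjacency matrix, as a list of rows.
encodeGraph : ∀ {n} → Graph n → Tree
encodeGraph G = encodeVec (encodeVec encodeBool) (tabulate λ u → tabulate λ v → adj G u v)

-- The characteristic vector.
encodeSubset : ∀ {n} → Subset n → Tree
encodeSubset = encodeVec encodeBool

------------------------------------------------------------------------
-- Instances

record ChordalInstance : Set where
  field
    {order}     : ℕ
    graph       : Graph order
    connected   : Connected graph
    chordal     : Chordal graph
    s t         : Fin order
    distinct    : s ≢ t
    nonAdjacent : ¬ Adj graph s t

encodeInstance : ChordalInstance → Tree
encodeInstance i = cons (encodeGraph graph) (cons (encodeFin s) (encodeFin t))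
  where open ChordalInstance i

{-# OPTIONS --safe #-}

-- In a chordal graph every (s,t)-separator contains an (s,t)-separator of the form N(a) ∩ N(b) with
-- a and b non-adjacent, which is a clique because G has no induced 4-cycle.  To find it inside S, let C be
-- the component of s in G − S and D the component of t in G − N(C).  Then N(D) ⊆ N(C), and chordality
-- yields a vertex a of C and a vertex b of D adjacent to all of N(D); since C and D are apart,
-- N(a) ∩ N(b) = N(D).  Hence a smallest separator among the sets N(a) ∩ N(b) is a minimum connected
-- separator, and there are only quadratically many of them to test.
module Submission where

open import Data.Bool.Base using (Bool; true; false; not) renaming (if_then_else_ to ifᵇ_then_else_)
open import Data.Bool.Properties using () renaming (_≟_ to _≟ᵇ_)
open import Data.Empty using (⊥-elim)
open import Data.Fin.Base using (Fin; zero; suc; toℕ; fromℕ)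
open import Data.Fin.Properties using (_≟_; any?; toℕ<n; toℕ-fromℕ)
open import Data.Fin.Subset using (Subset; _∈_; _∉_; _⊆_; _∩_; _∪_; ∁; ⊤; ⊥; ⁅_⁆; ∣_∣)
open import Data.Fin.Subset.Properties
open import Data.List.Base using (List; []; _∷_; length; allFin) renaming (lookup to lookupˡ)
open import Data.List.Membership.Propositional using () renaming (_∈_ to _∈ˡ_)
open import Data.List.Membership.Propositional.Properties using (∈-allFin; ∈-lookup)
open import Data.List.Relation.Unary.All as All using (All; []; _∷_)
open import Data.List.Relation.Unary.Any using (here; there)
open import Data.Nat.Base
open import Data.Nat.DivMod using (_%_; m<n⇒m%n≡m; n%n≡0)
open import Data.Nat.Properties hiding (_≟_)
open import Data.Product.Base using (∃-syntax; _×_; _,_; proj₁; proj₂)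
open import Data.Sum.Base using (_⊎_; inj₁; inj₂; [_,_]; swap)
open import Data.Vec.Base using (Vec; []; _∷_; lookup; zipWith; tabulate; _[_]≔_; here; there)
open import Data.Vec.Properties using (lookup∘tabulate; []=⇒lookup; lookup⇒[]=; ≡-dec)
open import Function.Base using (_∘_)
open import Function.Bundles using (_⇔_; mk⇔; Equivalence)
open import Relation.Binary.Construct.Closure.ReflexiveTransitive as Star using (Star; ε; _◅_; _◅◅_)
open import Relation.Binary.PropositionalEquality hiding ([_])
open import Relation.Nullary.Decidable using (Dec; yes; no; does; dec-true; map′; _×-dec_; ¬?)
open import Relation.Nullary.Negation using (¬_; contradiction)
open import Defs

-- Bounded executions

-- How `a` is found: start anywhere in C and treat the vertices of N(D) one at a time. To reach a
-- neighbour of the next such vertex y, follow an induced path through C towards y. A neighbour x of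
-- the current vertex that also has a neighbour in D is not lost on the way: the rest of the path, y
-- and D give a walk from the next vertex to x whose interior avoids the closed neighbourhood of the
-- current vertex, and chordality forces the missing edge. Exchanging C and D gives `b`. The search
-- neither tests connectedness nor skips pairs that are equal or adjacent; that the returned set is
-- a clique follows from comparing sizes. The other burden is timing programs with unbounded
-- `while`. The algorithm is therefore written in a typed language whose only repetition traverses
-- vectors of length n, so that a time bound is read off the syntax of a term, whatever the values
-- are.

Runs : ∀ {k} → Cmd k → Store k → ℕ → Store k → Set
Runs c σ B σ′ = ∃[ t ] (Exec c σ t σ′ × t ≤ B)

module _ {k : ℕ} where

  runs-weaken : ∀ {c : Cmd k} {σ B B′ σ′} → B ≤ B′ → Runs c σ B σ′ → Runs c σ B′ σ′
  runs-weaken B≤B′ (t , exec , t≤B) = t , exec , ≤-trans t≤B B≤B′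

  runs-assign : ∀ {x : Fin k} {e σ} → Runs (x := e) σ (suc (cost e)) (σ [ x ]≔ eval e σ)
  runs-assign = _ , assign , ≤-refl

  infixr 5 _⨾ᴿ_
  _⨾ᴿ_ : ∀ {c₁ c₂ : Cmd k} {σ σ₁ σ₂ B₁ B₂} →
         Runs c₁ σ B₁ σ₁ → Runs c₂ σ₁ B₂ σ₂ → Runs (c₁ ⨾ c₂) σ (B₁ + B₂) σ₂
  (_ , exec₁ , t₁≤B₁) ⨾ᴿ (_ , exec₂ , t₂≤B₂) = _ , seq exec₁ exec₂ , +-mono-≤ t₁≤B₁ t₂≤B₂

  -- The bound charges for both branches, so it does not depend on the outcome of the test. This is
  -- what lets `bound` depend on the length alone.
  runs-if-true : ∀ {e} {c₁ c₂ : Cmd k} {σ σ₁ B₁ B₂ a b} → eval e σ ≡ cons a b →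
                 Runs c₁ σ B₁ σ₁ → Runs (if e then c₁ else c₂) σ (suc (cost e) + (B₁ + B₂)) σ₁
  runs-if-true {e = e} {B₁ = B₁} {B₂} eq (_ , exec , t≤B) =
    _ , if-true eq exec , +-monoʳ-≤ (suc (cost e)) (≤-trans t≤B (m≤m+n B₁ B₂))

  runs-if-false : ∀ {e} {c₁ c₂ : Cmd k} {σ σ₁ B₁ B₂} → eval e σ ≡ nil →
                  Runs c₂ σ B₂ σ₁ → Runs (if e then c₁ else c₂) σ (suc (cost e) + (B₁ + B₂)) σ₁
  runs-if-false {e = e} {B₁ = B₁} {B₂} eq (_ , exec , t≤B) =
    _ , if-false eq exec , +-monoʳ-≤ (suc (cost e)) (≤-trans t≤B (m≤n+m B₂ B₁))

  runs-while-true : ∀ {e} {c : Cmd k} {σ σ₁ σ₂ B₁ B₂ a b} → eval e σ ≡ cons a b →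
                    Runs c σ B₁ σ₁ → Runs (while e loop c) σ₁ B₂ σ₂ →
                    Runs (while e loop c) σ ((suc (cost e) + B₁) + B₂) σ₂
  runs-while-true {e = e} {B₁ = B₁} {B₂} eq (_ , exec₁ , t₁≤B₁) (_ , exec₂ , t₂≤B₂) =
    _ , while-true eq exec₁ exec₂ ,
    ≤-trans (+-monoʳ-≤ (suc (cost e)) (+-mono-≤ t₁≤B₁ t₂≤B₂))
            (≤-reflexive (sym (+-assoc (suc (cost e)) B₁ B₂)))

  runs-while-false : ∀ {e} {c : Cmd k} {σ} → eval e σ ≡ nil →
                     Runs (while e loop c) σ (suc (cost e)) σ
  runs-while-false eq = _ , while-false eq , ≤-refl

-- A typed language in which every program runs in polynomial time

infixr 7 _⊗_

data Ty : Set where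
  bool nat : Ty
  _⊗_      : Ty → Ty → Ty
  vec      : Ty → Ty

Ctx : Set
Ctx = List Ty

-- All vectors have the same length n, so the time of a loop depends on n only.
Val : ℕ → Ty → Set
Val n bool    = Bool
Val n nat     = ℕ
Val n (τ ⊗ υ) = Val n τ × Val n υ
Val n (vec τ) = Vec (Val n τ) n

Env : ℕ → Ctx → Set
Env n = All (Val n)

infix 6 if′_then_else_

-- `loop` combines a left fold with a pointwise map over two vectors, and serves for both purposes.
-- No bound on the size of values is needed: the machine shares trees and charges one unit per
-- operator.
data Tm (Γ : Ctx) : Ty → Set where
  var            : ∀ {τ} → τ ∈ˡ Γ → Tm Γ τ
  let′           : ∀ {τ υ} → Tm Γ τ → Tm (τ ∷ Γ) υ → Tm Γ υ
  false′ true′   : Tm Γ bool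
  if′_then_else_ : ∀ {τ} → Tm Γ bool → Tm Γ τ → Tm Γ τ → Tm Γ τ
  zero′          : Tm Γ nat
  suc′ pred′     : Tm Γ nat → Tm Γ nat
  positive′      : Tm Γ nat → Tm Γ bool
  pair           : ∀ {τ υ} → Tm Γ τ → Tm Γ υ → Tm Γ (τ ⊗ υ)
  fst            : ∀ {τ υ} → Tm Γ (τ ⊗ υ) → Tm Γ τ
  snd            : ∀ {τ υ} → Tm Γ (τ ⊗ υ) → Tm Γ υ
  loop           : ∀ {α τ υ ω} → Tm Γ α → Tm Γ (vec τ) → Tm Γ (vec υ) →
                   Tm (υ ∷ τ ∷ α ∷ Γ) (α ⊗ ω) → Tm Γ (α ⊗ vec ω)

positive : ℕ → Bool
positive zero    = false
positive (suc _) = true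

mapAccum : ∀ {A X Y Z : Set} {m} → (A → X → Y → A × Z) → A → Vec X m → Vec Y m → A × Vec Z m
mapAccum f a []       []       = a , []
mapAccum f a (x ∷ xs) (y ∷ ys) =
  proj₁ rest , proj₂ (f a x y) ∷ proj₂ rest
  where rest = mapAccum f (proj₁ (f a x y)) xs ys

⟦_⟧ : ∀ {n Γ τ} → Tm Γ τ → Env n Γ → Val n τ
⟦ var i ⟧               ρ = All.lookup ρ i
⟦ let′ t u ⟧            ρ = ⟦ u ⟧ (⟦ t ⟧ ρ ∷ ρ)
⟦ false′ ⟧              ρ = false
⟦ true′ ⟧               ρ = true
⟦ if′ t then u else v ⟧ ρ = ifᵇ ⟦ t ⟧ ρ then ⟦ u ⟧ ρ else ⟦ v ⟧ ρ
⟦ zero′ ⟧               ρ = zero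
⟦ suc′ t ⟧              ρ = suc (⟦ t ⟧ ρ)
⟦ pred′ t ⟧             ρ = pred (⟦ t ⟧ ρ)
⟦ positive′ t ⟧         ρ = positive (⟦ t ⟧ ρ)
⟦ pair t u ⟧            ρ = ⟦ t ⟧ ρ , ⟦ u ⟧ ρ
⟦ fst t ⟧               ρ = proj₁ (⟦ t ⟧ ρ)
⟦ snd t ⟧               ρ = proj₂ (⟦ t ⟧ ρ)
⟦ loop t u v w ⟧        ρ = mapAccum (λ a x y → ⟦ w ⟧ (y ∷ x ∷ a ∷ ρ)) (⟦ t ⟧ ρ) (⟦ u ⟧ ρ) (⟦ v ⟧ ρ)

-- Compilation to a stack machine with two variables

enc : ∀ {n} τ → Val n τ → Tree
enc bool    b       = encodeBool b
enc nat     m       = encodeℕ m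
enc (τ ⊗ υ) (x , y) = cons (enc τ x) (enc υ y)
enc (vec τ) xs      = encodeVec (enc τ) xs

encEnv : ∀ {n Γ} → Env n Γ → Tree
encEnv []            = nil
encEnv (_∷_ {τ} x ρ) = cons (enc τ x) (encEnv ρ)

-- The environment is kept in E; a term pushes its value onto the stack K.
E K : Fin 2
E = zero
K = suc zero

env stk : Expr 2
env = var E
stk = var K

top second third : Expr 2
top    = hd stk
second = hd (tl stk)
third  = hd (tl (tl stk))

fetch : ∀ {Γ : Ctx} {τ} → τ ∈ˡ Γ → Expr 2 → Expr 2
fetch (here _)  x = hd x
fetch (there i) x = fetch i (tl x)

-- During the loop the stack is xs, ys, accumulator, reversed output.
loop-body : Cmd 2 → Cmd 2
loop-body c =
  E := cons (hd second) (cons (hd top) (cons third env)) ⨾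
  c ⨾
  E := tl (tl (tl env)) ⨾
  K := cons (tl second) (cons (tl third) (cons (hd top)
         (cons (cons (tl top) (hd (tl (tl (tl (tl stk)))))) (tl (tl (tl (tl (tl stk))))))))

reverse-body : Cmd 2
reverse-body = K := cons (tl top) (cons (cons (hd top) second) (tl (tl stk)))

-- The stack changes from ys, xs, accumulator to the layout of `loop-body`; then from nil, nil,
-- accumulator, reversed output to reversed output, nil, accumulator; finally from nil, output,
-- accumulator to a single pair.
loop-prepare reverse-prepare loop-finish : Cmd 2
loop-prepare    = K := cons second (cons top (cons third (cons nil (tl (tl (tl stk))))))
reverse-prepare = K := cons (hd (tl (tl (tl stk)))) (cons nil (cons third (tl (tl (tl (tl stk))))))
loop-finish     = K := cons (cons third second) (tl (tl (tl stk)))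

compile : ∀ {Γ τ} → Tm Γ τ → Cmd 2
compile (var i)               = K := cons (fetch i env) stk
compile (let′ t u)            = compile t ⨾ E := cons top env ⨾ K := tl stk ⨾ compile u ⨾ E := tl env
compile false′                = K := cons nil stk
compile true′                 = K := cons (cons nil nil) stk
compile (if′ t then u else v) =
  compile t ⨾ (if top then (K := tl stk ⨾ compile u) else (K := tl stk ⨾ compile v))
compile zero′                 = K := cons nil stk
compile (suc′ t)              = compile t ⨾ K := cons (cons nil top) (tl stk)
compile (pred′ t)             = compile t ⨾ K := cons (tl top) (tl stk)
compile (positive′ t)         =
  compile t ⨾ (if top then K := cons (cons nil nil) (tl stk) else K := cons nil (tl stk))
compile (pair t u)            = compile t ⨾ compile u ⨾ K := cons (cons second top) (tl (tl stk))
compile (fst t)               = compile t ⨾ K := cons (hd top) (tl stk)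
compile (snd t)               = compile t ⨾ K := cons (tl top) (tl stk)
compile (loop t u v w)        =
  compile t ⨾ compile u ⨾ compile v ⨾
  loop-prepare ⨾ while top loop loop-body (compile w) ⨾
  reverse-prepare ⨾ while top loop reverse-body ⨾ loop-finish

-- The numerals in the bounds are the costs of the tests and assignments above.
iteration-time : ℕ → ℕ
iteration-time b = 3 + (16 + (b + (5 + 33)))

reverse-time : ℕ
reverse-time = 3 + 16

bound : ∀ {Γ τ} → Tm Γ τ → ℕ → ℕ
bound (var i)               n = suc (cost (cons (fetch i env) stk))
bound (let′ t u)            n = bound t n + (5 + (3 + (bound u n + 3)))
bound false′                n = 4
bound true′                 n = 6
bound (if′ t then u else v) n = bound t n + (3 + ((3 + bound u n) + (3 + bound v n)))
bound zero′                 n = 4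
bound (suc′ t)              n = bound t n + 8
bound (pred′ t)             n = bound t n + 7
bound (positive′ t)         n = bound t n + (3 + (7 + 5))
bound (pair t u)            n = bound t n + (bound u n + 11)
bound (fst t)               n = bound t n + 7
bound (snd t)               n = bound t n + 7
bound (loop t u v w)        n =
  bound t n + (bound u n + (bound v n +
  (19 + ((n * iteration-time (bound w n) + 3) + (19 + ((n * reverse-time + 3) + 14))))))

-- Correctness and running time of compiled terms

prepend : ∀ {A : Set} {m} → (A → Tree) → Vec A m → Tree → Tree
prepend f []       o = o
prepend f (z ∷ zs) o = cons (f z) (prepend f zs o)

prepend-nil : ∀ {A : Set} {m} (f : A → Tree) (zs : Vec A m) → prepend f zs nil ≡ encodeVec f zs
prepend-nil f []       = refl
prepend-nil f (z ∷ zs) = cong (cons (f z)) (prepend-nil f zs)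

reversed : ∀ {A : Set} {m} → (A → Tree) → Vec A m → Tree → Tree
reversed f []       o = o
reversed f (z ∷ zs) o = reversed f zs (cons (f z) o)

module _ {A : Set} (f : A → Tree) {ρ a r : Tree} where

  private
    stack : Tree → Tree → Store 2
    stack o fwd = ρ ∷ cons o (cons fwd (cons a r)) ∷ []

  -- The loop pops the last element of `zs` first, so the head of `zs` belongs to the final
  -- iteration. Hence `go` takes the run that remains after `zs` has been moved and puts the
  -- iterations for `zs` in front of it.
  runs-reverse : ∀ {m} (zs : Vec A m) →
    Runs (while top loop reverse-body) (stack (reversed f zs nil) nil) (m * reverse-time + 3)
         (stack nil (encodeVec f zs))
  runs-reverse zs =
    go zs nil (subst (λ fwd → Runs _ (stack nil (prepend f zs nil)) 3 (stack nil fwd))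
                     (prepend-nil f zs) (runs-while-false refl))
    where
    go : ∀ {m B σ} (zs : Vec A m) fwd {o} →
      Runs (while top loop reverse-body) (stack o (prepend f zs fwd)) B σ →
      Runs (while top loop reverse-body) (stack (reversed f zs o) fwd) (m * reverse-time + B) σ
    go []       fwd run = run
    go {suc m} {B} (z ∷ zs) fwd run =
      runs-weaken
        (≤-reflexive (trans (sym (+-assoc (m * reverse-time) reverse-time B))
                            (cong (_+ B) (+-comm (m * reverse-time) reverse-time))))
        (go zs fwd (runs-while-true refl runs-assign run))

eval-fetch : ∀ {n Γ τ} (i : τ ∈ˡ Γ) (ρ : Env n Γ) x σ → eval x σ ≡ encEnv ρ →
             eval (fetch i x) σ ≡ enc τ (All.lookup ρ i)
eval-fetch (here refl) (v ∷ ρ) x σ eq = cong hdTree eq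
eval-fetch (there i)   (v ∷ ρ) x σ eq = eval-fetch i ρ (tl x) σ (cong tlTree eq)

-- The rest `r` of the stack is arbitrary because a subterm is run on top of values pushed earlier.
Computes : ∀ {n Γ τ} → Tm Γ τ → Env n Γ → Set
Computes {n} {Γ} {τ} t ρ = ∀ r →
  Runs (compile t) (encEnv ρ ∷ r ∷ []) (bound t n) (encEnv ρ ∷ cons (enc τ (⟦ t ⟧ ρ)) r ∷ [])

module _ {n Γ α τ υ ω} (w : Tm (υ ∷ τ ∷ α ∷ Γ) (α ⊗ ω)) (ρ : Env n Γ)
         (w-computes : ∀ a x y → Computes w (y ∷ x ∷ a ∷ ρ)) where

  private
    f : Val n α → Val n τ → Val n υ → Val n (α ⊗ ω)
    f a x y = ⟦ w ⟧ (y ∷ x ∷ a ∷ ρ)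

    stack : Tree → Tree → Val n α → Tree → Tree → Store 2
    stack xs ys a o r = encEnv ρ ∷ cons xs (cons ys (cons (enc α a) (cons o r))) ∷ []

  -- The length `m` is kept apart from `n`: the traversed vectors shrink, while those in `ρ` and the
  -- bound for `w` still refer to `n`.
  runs-iterations : ∀ {m r} a (xs : Vec (Val n τ) m) (ys : Vec (Val n υ) m) o →
    Runs (while top loop loop-body (compile w))
         (stack (encodeVec (enc τ) xs) (encodeVec (enc υ) ys) a o r)
         (m * iteration-time (bound w n) + 3)
         (stack nil nil (proj₁ (mapAccum f a xs ys)) (reversed (enc ω) (proj₂ (mapAccum f a xs ys)) o) r)
  runs-iterations a []       []       o = runs-while-false refl
  runs-iterations {suc m} a (x ∷ xs) (y ∷ ys) o =
    runs-weaken (≤-reflexive (sym (+-assoc (iteration-time (bound w n)) (m * iteration-time (bound w n)) 3)))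
      (runs-while-true refl (runs-assign ⨾ᴿ w-computes a x y _ ⨾ᴿ runs-assign ⨾ᴿ runs-assign)
        (runs-iterations (proj₁ (f a x y)) xs ys (cons (enc ω (proj₂ (f a x y))) o)))

compile-correct : ∀ {n Γ τ} (t : Tm Γ τ) (ρ : Env n Γ) → Computes t ρ
compile-correct (var i) ρ r =
  subst (λ v → Runs _ _ _ (encEnv ρ ∷ cons v r ∷ [])) (eval-fetch i ρ (var E) (encEnv ρ ∷ r ∷ []) refl) runs-assign
compile-correct (let′ t u) ρ r =
  compile-correct t ρ r ⨾ᴿ runs-assign ⨾ᴿ runs-assign ⨾ᴿ compile-correct u (⟦ t ⟧ ρ ∷ ρ) r ⨾ᴿ runs-assign
compile-correct false′ ρ r = runs-assign
compile-correct true′ ρ r = runs-assign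
compile-correct (if′ t then u else v) ρ r = compile-correct t ρ r ⨾ᴿ branch (⟦ t ⟧ ρ)
  where
  branch : ∀ b → Runs (if top then (K := tl stk ⨾ compile u) else (K := tl stk ⨾ compile v))
                      (encEnv ρ ∷ cons (encodeBool b) r ∷ [])
                      (3 + ((3 + bound u _) + (3 + bound v _)))
                      (encEnv ρ ∷ cons (enc _ (ifᵇ b then ⟦ u ⟧ ρ else ⟦ v ⟧ ρ)) r ∷ [])
  branch true  = runs-if-true {B₂ = 3 + bound v _} refl (runs-assign ⨾ᴿ compile-correct u ρ r)
  branch false = runs-if-false {B₁ = 3 + bound u _} refl (runs-assign ⨾ᴿ compile-correct v ρ r)
compile-correct zero′ ρ r = runs-assign
compile-correct (suc′ t) ρ r = compile-correct t ρ r ⨾ᴿ runs-assign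
compile-correct (pred′ t) ρ r =
  subst (λ v → Runs _ _ _ (encEnv ρ ∷ cons v r ∷ [])) (tl-encodeℕ (⟦ t ⟧ ρ))
    (compile-correct t ρ r ⨾ᴿ runs-assign)
  where
  tl-encodeℕ : ∀ m → tlTree (encodeℕ m) ≡ encodeℕ (pred m)
  tl-encodeℕ zero    = refl
  tl-encodeℕ (suc m) = refl
compile-correct (positive′ t) ρ r = compile-correct t ρ r ⨾ᴿ branch (⟦ t ⟧ ρ)
  where
  branch : ∀ m → Runs (if top then K := cons (cons nil nil) (tl stk) else K := cons nil (tl stk))
                      (encEnv ρ ∷ cons (encodeℕ m) r ∷ []) (3 + (7 + 5))
                      (encEnv ρ ∷ cons (encodeBool (positive m)) r ∷ [])
  branch zero    = runs-if-false {B₁ = 7} refl runs-assign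
  branch (suc m) = runs-if-true {B₂ = 5} refl runs-assign
compile-correct (pair t u) ρ r = compile-correct t ρ r ⨾ᴿ compile-correct u ρ _ ⨾ᴿ runs-assign
compile-correct (fst t) ρ r = compile-correct t ρ r ⨾ᴿ runs-assign
compile-correct (snd t) ρ r = compile-correct t ρ r ⨾ᴿ runs-assign
compile-correct (loop t u v w) ρ r =
  compile-correct t ρ r ⨾ᴿ compile-correct u ρ _ ⨾ᴿ compile-correct v ρ _ ⨾ᴿ
  runs-assign ⨾ᴿ runs-iterations w ρ (λ a x y → compile-correct w (y ∷ x ∷ a ∷ ρ)) _ (⟦ u ⟧ ρ) (⟦ v ⟧ ρ) nil ⨾ᴿ
  runs-assign ⨾ᴿ runs-reverse (enc _) (proj₂ (⟦ loop t u v w ⟧ ρ)) ⨾ᴿ runs-assign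

-- Polynomial bounds

-- The base `suc n` is at least 1, so degrees can be raised freely in sums, and it is at most the
-- input size as soon as n is smaller than that size.
Polynomial : (ℕ → ℕ) → Set
Polynomial f = ∃[ c ] ∃[ d ] (∀ n → f n ≤ c * suc n ^ d)

poly-const : ∀ c → Polynomial (λ _ → c)
poly-const c = c , 0 , λ _ → ≤-reflexive (sym (*-identityʳ c))

poly-id : Polynomial (λ n → n)
poly-id = 1 , 1 , λ n → ≤-trans (n≤1+n n) (≤-reflexive (sym (trans (*-identityˡ _) (*-identityʳ (suc n)))))

poly-+ : ∀ {f g} → Polynomial f → Polynomial g → Polynomial (λ n → f n + g n)
poly-+ {f} {g} (c₁ , d₁ , f≤) (c₂ , d₂ , g≤) = c₁ + c₂ , d₁ + d₂ , λ n → begin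
  f n + g n                                         ≤⟨ +-mono-≤ (f≤ n) (g≤ n) ⟩
  c₁ * suc n ^ d₁ + c₂ * suc n ^ d₂                 ≤⟨ +-mono-≤ (*-monoʳ-≤ c₁ (^-monoʳ-≤ (suc n) (m≤m+n d₁ d₂)))
                                                                (*-monoʳ-≤ c₂ (^-monoʳ-≤ (suc n) (m≤n+m d₂ d₁))) ⟩
  c₁ * suc n ^ (d₁ + d₂) + c₂ * suc n ^ (d₁ + d₂)   ≡⟨ *-distribʳ-+ (suc n ^ (d₁ + d₂)) c₁ c₂ ⟨
  (c₁ + c₂) * suc n ^ (d₁ + d₂)                     ∎
  where open ≤-Reasoning

poly-* : ∀ {f g} → Polynomial f → Polynomial g → Polynomial (λ n → f n * g n)
poly-* {f} {g} (c₁ , d₁ , f≤) (c₂ , d₂ , g≤) = c₁ * c₂ , d₁ + d₂ , λ n → begin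
  f n * g n                                 ≤⟨ *-mono-≤ (f≤ n) (g≤ n) ⟩
  (c₁ * suc n ^ d₁) * (c₂ * suc n ^ d₂)     ≡⟨ [m*n]*[o*p]≡[m*o]*[n*p] c₁ (suc n ^ d₁) c₂ (suc n ^ d₂) ⟩
  (c₁ * c₂) * (suc n ^ d₁ * suc n ^ d₂)     ≡⟨ cong (c₁ * c₂ *_) (^-distribˡ-+-* (suc n) d₁ d₂) ⟨
  (c₁ * c₂) * suc n ^ (d₁ + d₂)             ∎
  where open ≤-Reasoning

poly-bound : ∀ {Γ τ} (t : Tm Γ τ) → Polynomial (bound t)
poly-bound (var i)               = poly-const _
poly-bound (let′ t u)            =
  poly-+ (poly-bound t) (poly-+ (poly-const 5) (poly-+ (poly-const 3) (poly-+ (poly-bound u) (poly-const 3))))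
poly-bound false′                = poly-const 4
poly-bound true′                 = poly-const 6
poly-bound (if′ t then u else v) =
  poly-+ (poly-bound t) (poly-+ (poly-const 3)
    (poly-+ (poly-+ (poly-const 3) (poly-bound u)) (poly-+ (poly-const 3) (poly-bound v))))
poly-bound zero′                 = poly-const 4
poly-bound (suc′ t)              = poly-+ (poly-bound t) (poly-const 8)
poly-bound (pred′ t)             = poly-+ (poly-bound t) (poly-const 7)
poly-bound (positive′ t)         = poly-+ (poly-bound t) (poly-const 15)
poly-bound (pair t u)            = poly-+ (poly-bound t) (poly-+ (poly-bound u) (poly-const 11))
poly-bound (fst t)               = poly-+ (poly-bound t) (poly-const 7)
poly-bound (snd t)               = poly-+ (poly-bound t) (poly-const 7)
poly-bound (loop t u v w)        =
  poly-+ (poly-bound t) (poly-+ (poly-bound u) (poly-+ (poly-bound v)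
    (poly-+ (poly-const 19) (poly-+ (poly-+ (poly-* poly-id poly-iteration) (poly-const 3))
      (poly-+ (poly-const 19) (poly-+ (poly-+ (poly-* poly-id (poly-const reverse-time)) (poly-const 3))
        (poly-const 14)))))))
  where
  poly-iteration : Polynomial (λ n → iteration-time (bound w n))
  poly-iteration = poly-+ (poly-const 3) (poly-+ (poly-const 16) (poly-+ (poly-bound w) (poly-const 38)))

-- From typed terms to polynomial-time search problems

compileMain : ∀ {τ υ} → Tm (τ ∷ []) υ → Program
compileMain t = program (E := cons (var E) nil ⨾ compile t ⨾ E := top)

compileMain-time : ∀ {τ υ} → Tm (τ ∷ []) υ → ℕ → ℕ
compileMain-time t n = 4 + (bound t n + 3)

compileMain-correct : ∀ {n τ υ} (t : Tm (τ ∷ []) υ) (x : Val n τ) →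
  ∃[ m ] (HaltsWith (compileMain t) (enc τ x) m (enc υ (⟦ t ⟧ (x ∷ []))) × m ≤ compileMain-time t n)
compileMain-correct t x with runs-assign ⨾ᴿ compile-correct t (x ∷ []) nil ⨾ᴿ runs-assign
... | m , exec , m≤ = m , (_ , exec , refl) , m≤

poly-compileMain-time : ∀ {τ υ} (t : Tm (τ ∷ []) υ) → Polynomial (compileMain-time t)
poly-compileMain-time t = poly-+ (poly-const 4) (poly-+ (poly-bound t) (poly-const 3))

-- The interface between machine and mathematics: what remains is to write a term and to show that
-- its denotation is a correct solution.
term-polyTimeSolvable :
  ∀ {τ υ} {I : Set} {O : I → Set} {encodeIn encodeOut} {R : ∀ i → O i → Set}
  (t : Tm (τ ∷ []) υ) (n : I → ℕ) (input : ∀ i → Val (n i) τ) (solution : ∀ i → O i) →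
  (∀ i → enc τ (input i) ≡ encodeIn i) →
  (∀ i → enc υ (⟦ t ⟧ (input i ∷ [])) ≡ encodeOut i (solution i)) →
  (∀ i → n i < size (encodeIn i)) →
  (∀ i → R i (solution i)) →
  PolyTimeSolvable encodeIn encodeOut R
term-polyTimeSolvable t n input solution input≡ output≡ n<size correct
  with poly-compileMain-time t
... | c , d , time≤ = compileMain t , c , d , λ i →
  let m , halts , m≤ = compileMain-correct t (input i) in
  solution i , m ,
  subst₂ (λ x y → HaltsWith (compileMain t) x m y) (input≡ i) (output≡ i) halts ,
  ≤-trans m≤ (≤-trans (time≤ (n i)) (*-monoʳ-≤ c (^-monoˡ-≤ d (n<size i)))) ,
  correct i

-- Separators of chordal graphs

suc-mod : ∀ k .{{_ : NonZero k}} {i} → i < k → (suc i < k × suc i % k ≡ suc i) ⊎ (suc i ≡ k × suc i % k ≡ 0)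
suc-mod k i<k with m≤n⇒m<n∨m≡n i<k
... | inj₁ si<k = inj₁ (si<k , m<n⇒m%n≡m si<k)
... | inj₂ refl = inj₂ (refl , n%n≡0 k)

module _ {n : ℕ} (G : Graph n) where

  private
    V : Set
    V = Fin n

  open Graph G using (irrefl)

  _~_ : V → V → Set
  u ~ v = Adj G u v

  ~-sym : ∀ {u v} → u ~ v → v ~ u
  ~-sym {u} {v} u~v = trans (Graph.sym G v u) u~v

  ~-irrefl : ∀ {v} → ¬ v ~ v
  ~-irrefl {v} v~v = contradiction (trans (sym v~v) (irrefl v)) λ ()

  _~?_ : ∀ u v → Dec (u ~ v)
  u ~? v = Graph.adj G u v ≟ᵇ true

  -- All vertices of the walk other than the first satisfy P.
  Walk : (V → Set) → V → V → Set
  Walk P = Star (λ u v → u ~ v × P v)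

  Far : V → V → Set
  Far u v = u ≢ v × ¬ u ~ v

  -- InducedPath y x vs: the vertices x ∷ vs form an induced path ending in y.
  data InducedPath (y : V) : V → List V → Set where
    []  : InducedPath y y []
    _∷_ : ∀ {x z vs} → x ~ z × All (Far x) vs → InducedPath y z vs → InducedPath y x (z ∷ vs)

  -- The last vertex on the path that equals or is adjacent to x starts the shortcut.
  shortcut : ∀ {P : V → Set} {y z vs} x → InducedPath y z vs → All P (z ∷ vs) →
             All (Far x) (z ∷ vs) ⊎ (∃[ ws ] (InducedPath y x ws × All P ws))
  shortcut {z = z} x path (pz ∷ ps) with rest path ps
    where
    rest : ∀ {P : V → Set} {y z vs} → InducedPath y z vs → All P vs →
           All (Far x) vs ⊎ (∃[ ws ] (InducedPath y x ws × All P ws))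
    rest []         []  = inj₁ []
    rest (_ ∷ path) ps  = shortcut x path ps
  ... | inj₂ found = inj₂ found
  ... | inj₁ far with x ≟ z
  ...   | yes refl = inj₂ (_ , path , ps)
  ...   | no x≢z with x ~? z
  ...     | yes x~z = inj₂ (_ , (x~z , far) ∷ path , pz ∷ ps)
  ...     | no x≁z = inj₁ ((x≢z , x≁z) ∷ far)

  -- The walk is processed from its end. Each new vertex is adjacent to the first vertex of the
  -- remaining walk, so `shortcut` cannot report it to be far from everything.
  walk⇒inducedPath : ∀ {P x y} → Walk P x y → ∃[ vs ] (InducedPath y x vs × All P vs)
  walk⇒inducedPath ε = [] , [] , []
  walk⇒inducedPath {x = x} ((x~z , pz) ◅ walk) with walk⇒inducedPath walk
  ... | vs , path , ps with shortcut x path (pz ∷ ps)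
  ...   | inj₂ found               = found
  ...   | inj₁ ((_ , x≁z) ∷ _) = contradiction x~z x≁z

  inducedPath⇒walk : ∀ {P x y vs} → InducedPath y x vs → All P vs → Walk P x y
  inducedPath⇒walk []               []        = ε
  inducedPath⇒walk ((x~z , _) ∷ path) (pz ∷ ps) = (x~z , pz) ◅ inducedPath⇒walk path ps

  path-injective : ∀ {y x vs} → InducedPath y x vs → ∀ i j →
                   lookupˡ (x ∷ vs) i ≡ lookupˡ (x ∷ vs) j → i ≡ j
  path-injective path zero zero eq = refl
  path-injective ((x~z , far) ∷ path) zero (suc zero) refl = contradiction x~z ~-irrefl
  path-injective ((x~z , far) ∷ path) zero (suc (suc j)) eq =
    contradiction eq (proj₁ (All.lookup far (∈-lookup j)))
  path-injective ((x~z , far) ∷ path) (suc zero) zero refl = contradiction x~z ~-irrefl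
  path-injective ((x~z , far) ∷ path) (suc (suc i)) zero eq =
    contradiction (sym eq) (proj₁ (All.lookup far (∈-lookup i)))
  path-injective (_ ∷ path) (suc i) (suc j) eq = cong suc (path-injective path i j eq)

  Consecutive : ∀ {k} → Fin k → Fin k → Set
  Consecutive i j = toℕ j ≡ suc (toℕ i) ⊎ toℕ i ≡ suc (toℕ j)

  consecutive-suc : ∀ {k} {i j : Fin k} → Consecutive i j → Consecutive (suc i) (suc j)
  consecutive-suc (inj₁ eq) = inj₁ (cong suc eq)
  consecutive-suc (inj₂ eq) = inj₂ (cong suc eq)

  path-adj⇒consecutive : ∀ {y x vs} → InducedPath y x vs → ∀ i j →
    lookupˡ (x ∷ vs) i ~ lookupˡ (x ∷ vs) j → Consecutive i j
  path-adj⇒consecutive path zero zero adj = contradiction adj ~-irrefl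
  path-adj⇒consecutive (_ ∷ path) zero (suc zero) adj = inj₁ refl
  path-adj⇒consecutive ((_ , far) ∷ path) zero (suc (suc j)) adj =
    contradiction adj (proj₂ (All.lookup far (∈-lookup j)))
  path-adj⇒consecutive (_ ∷ path) (suc zero) zero adj = inj₂ refl
  path-adj⇒consecutive ((_ , far) ∷ path) (suc (suc i)) zero adj =
    contradiction (~-sym adj) (proj₂ (All.lookup far (∈-lookup i)))
  path-adj⇒consecutive (_ ∷ path) (suc i) (suc j) adj =
    consecutive-suc (path-adj⇒consecutive path i j adj)

  successor⇒path-adj : ∀ {y x vs} → InducedPath y x vs → ∀ i j → toℕ j ≡ suc (toℕ i) →
    lookupˡ (x ∷ vs) i ~ lookupˡ (x ∷ vs) j
  successor⇒path-adj ((x~z , _) ∷ path) zero (suc zero) refl = x~z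
  successor⇒path-adj (_ ∷ path) (suc i) (suc j) eq =
    successor⇒path-adj path i j (suc-injective eq)

  consecutive⇒path-adj : ∀ {y x vs} → InducedPath y x vs → ∀ i j → Consecutive i j →
    lookupˡ (x ∷ vs) i ~ lookupˡ (x ∷ vs) j
  consecutive⇒path-adj path i j (inj₁ eq) = successor⇒path-adj path i j eq
  consecutive⇒path-adj path i j (inj₂ eq) = ~-sym (successor⇒path-adj path j i eq)

  path-end : ∀ {y x vs} → InducedPath y x vs → ∀ i → toℕ i ≡ length vs → lookupˡ (x ∷ vs) i ≡ y
  path-end []         zero    eq = refl
  path-end (_ ∷ path) (suc i) eq = path-end path i (suc-injective eq)

  path-end⁻¹ : ∀ {y x vs} → InducedPath y x vs → ∀ i → lookupˡ (x ∷ vs) i ≡ y → toℕ i ≡ length vs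
  path-end⁻¹ {vs = vs} path i eq =
    trans (cong toℕ (path-injective path i (fromℕ (length vs))
            (trans eq (sym (path-end path (fromℕ (length vs)) (toℕ-fromℕ _))))))
          (toℕ-fromℕ _)

  -- An apex `v` closes an induced path to an induced cycle. The list `vs` includes the end `y`,
  -- which is why `interior` must exempt it. The apex gets index zero, so the wrap-around of the
  -- cycle is the edge from `y` back to `v`.
  module _ {v x y vs} (path : InducedPath y x vs) (v~x : v ~ x) (v~y : v ~ y)
           (interior : All (λ w → w ≡ y ⊎ Far v w) vs) where

    private
      k : ℕ
      k = suc (suc (length vs))

      cycle : Fin k → V
      cycle = lookupˡ (v ∷ x ∷ vs)

      apex-adj⇒end : ∀ i → v ~ lookupˡ (x ∷ vs) i → i ≡ zero ⊎ toℕ i ≡ length vs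
      apex-adj⇒end zero    adj = inj₁ refl
      apex-adj⇒end (suc i) adj with All.lookup interior (∈-lookup i)
      ... | inj₁ eq          = inj₂ (path-end⁻¹ path (suc i) eq)
      ... | inj₂ (_ , v≁w) = contradiction adj v≁w

      apex≢path : ∀ i → v ≢ lookupˡ (x ∷ vs) i
      apex≢path zero    refl = ~-irrefl v~x
      apex≢path (suc i) eq with All.lookup interior (∈-lookup i)
      ... | inj₁ w≡y         = ~-irrefl (subst (v ~_) (sym (trans eq w≡y)) v~y)
      ... | inj₂ (v≢w , _) = v≢w eq

      injective : ∀ {i j} → cycle i ≡ cycle j → i ≡ j
      injective {zero}  {zero}  eq = refl
      injective {zero}  {suc j} eq = contradiction eq (apex≢path j)
      injective {suc i} {zero}  eq = contradiction (sym eq) (apex≢path i)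
      injective {suc i} {suc j} eq = cong suc (path-injective path i j eq)

      apex⇒ : ∀ i → v ~ lookupˡ (x ∷ vs) i → CycleAdj k zero (suc i)
      apex⇒ i adj with apex-adj⇒end i adj
      ... | inj₁ refl = inj₁ refl
      ... | inj₂ eq   = inj₂ (sym (trans (cong (λ m → suc (suc m) % k) eq) (n%n≡0 k)))

      apex⇐ : ∀ i → CycleAdj k zero (suc i) → v ~ lookupˡ (x ∷ vs) i
      apex⇐ zero    (inj₁ eq) = v~x
      apex⇐ i (inj₂ eq) with suc-mod k (toℕ<n (suc i))
      ... | inj₁ (_ , eq′) = contradiction (trans eq eq′) 0≢1+n
      ... | inj₂ (eq′ , _) = subst (v ~_) (sym (path-end path i (suc-injective (suc-injective eq′)))) v~y
      apex⇐ (suc i) (inj₁ eq) = contradiction (suc-injective eq) λ ()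

      -- Wrapping around would give index zero, the apex; between two vertices of the path the
      -- modulus therefore has no effect.
      successor⇒mod : ∀ (i j : Fin (suc (length vs))) → toℕ j ≡ suc (toℕ i) → suc (toℕ j) ≡ suc (suc (toℕ i)) % k
      successor⇒mod i j eq with suc-mod k (toℕ<n (suc i))
      ... | inj₁ (_ , eq′) = trans (cong suc eq) (sym eq′)
      ... | inj₂ (eq′ , _) = contradiction (toℕ<n j) (λ j< → <-irrefl (trans eq (suc-injective eq′)) j<)

      mod⇒successor : ∀ (i j : Fin (suc (length vs))) → suc (toℕ j) ≡ suc (suc (toℕ i)) % k → toℕ j ≡ suc (toℕ i)
      mod⇒successor i j eq with suc-mod k (toℕ<n (suc i))
      ... | inj₁ (_ , eq′) = suc-injective (trans eq eq′)
      ... | inj₂ (_ , eq′) = contradiction (sym (trans eq eq′)) 0≢1+n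

      adjacency : ∀ i j → (cycle i ~ cycle j) ⇔ CycleAdj k i j
      adjacency zero    zero    = mk⇔ (⊥-elim ∘ ~-irrefl) λ { (inj₁ ()) ; (inj₂ ()) }
      adjacency zero    (suc j) = mk⇔ (apex⇒ j) (apex⇐ j)
      adjacency (suc i) zero    = mk⇔ (swap ∘ apex⇒ i ∘ ~-sym) (~-sym ∘ apex⇐ i ∘ swap)
      adjacency (suc i) (suc j) = mk⇔
        ([ inj₁ ∘ successor⇒mod i j , inj₂ ∘ successor⇒mod j i ] ∘ path-adj⇒consecutive path i j)
        (consecutive⇒path-adj path i j ∘ [ inj₁ ∘ mod⇒successor i j , inj₂ ∘ mod⇒successor j i ])

    coned-inducedPath-isInducedCycle : IsInducedCycle G k cycle
    coned-inducedPath-isInducedCycle = injective , adjacency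

  CommonNeighbours : V → V → Subset n → Set
  CommonNeighbours a b K = ∀ v → v ∈ K ⇔ (a ~ v × b ~ v)

  module _ (chordal : Chordal G) where

    -- This is the form in which chordality is used. An induced path extracted from the walk, if it
    -- had two or more edges, would close through `v` to an induced cycle of length at least 4.
    cone-adjacent : ∀ {v x y} → v ~ x → v ~ y → Walk (λ w → w ≡ y ⊎ Far v w) x y → x ≡ y ⊎ x ~ y
    cone-adjacent v~x v~y walk with walk⇒inducedPath walk
    ... | [] , [] , _ = inj₁ refl
    ... | _ ∷ [] , (x~y , _) ∷ [] , _ = inj₂ x~y
    -- The apex, the start and the two displayed vertices make the cycle length `4 + length vs`.
    ... | _ ∷ _ ∷ vs , path , interior =
      contradiction (coned-inducedPath-isInducedCycle path v~x v~y interior) (chordal (length vs) _)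

    module _ {C D : V → Set} (C? : ∀ v → Dec (C v)) (D? : ∀ v → Dec (D v))
             (C-connected : ∀ {u v} → C u → C v → Walk C u v)
             (D-connected : ∀ {u v} → D u → D v → Walk D u v)
             (apart : ∀ {u v} → C u → D v → Far u v) where

      private
        -- Symmetric in `C` and `D`, so that exchanging the two yields a second dominating vertex
        -- for the same vertices.
        Attached : V → Set
        Attached x = (∃[ c ] (C c × c ~ x)) × (∃[ d ] (D d × d ~ x))

        Attached? : ∀ x → Dec (Attached x)
        Attached? x = any? (λ c → C? c ×-dec c ~? x) ×-dec any? (λ d → D? d ×-dec d ~? x)

        attached⇒∉C : ∀ {x} → Attached x → ¬ C x
        attached⇒∉C (_ , d , d∈D , d~x) x∈C = proj₂ (apart x∈C d∈D) (~-sym d~x)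

        Keeps : V → V → Set
        Keeps a a′ = ∀ {x} → Attached x → a ~ x → a′ ~ x

        -- If a has no neighbour on the rest of the path, the path and D join its second vertex to
        -- every attached neighbour of a, so cone-adjacent with apex a applies.
        advance : ∀ {y a vs} → Attached y → C a → InducedPath y a vs → All (λ w → C w ⊎ w ≡ y) vs →
                  ∃[ a′ ] (C a′ × Keeps a a′ × a′ ~ y)
        advance y-att a∈C [] [] = contradiction a∈C (attached⇒∉C y-att)
        advance y-att a∈C ((a~z , _) ∷ path) (inj₂ refl ∷ _) = _ , a∈C , (λ _ adj → adj) , a~z
        advance {y} {a} y-att@(_ , d , d∈D , d~y) a∈C (_∷_ {z = z} (a~z , far) path) (inj₁ z∈C ∷ ps)
          with advance y-att z∈C path ps
        ... | a′ , a′∈C , keeps , a′~y = a′ , a′∈C , (λ x-att a~x → keeps x-att (step x-att a~x)) , a′~y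
          where
          step : Keeps a z
          step {x} x-att@(_ , d′ , d′∈D , d′~x) a~x
            with cone-adjacent a~z a~x
                   (inducedPath⇒walk path (All.map inj₂ far) ◅◅
                    (~-sym d~y , inj₂ (apart a∈C d∈D)) ◅
                    Star.map (λ (adj , w∈D) → adj , inj₂ (apart a∈C w∈D)) (D-connected d∈D d′∈D) ◅◅
                    (d′~x , inj₁ refl) ◅ ε)
          ... | inj₁ refl = contradiction z∈C (attached⇒∉C x-att)
          ... | inj₂ z~x  = z~x

        -- Induction over the vertices to be dominated. For a new attached x, an induced path
        -- through `C` to x is handed to `advance`, and `Keeps` guarantees that the attached
        -- vertices dominated so far stay dominated.
        dominate : ∀ {r} → C r → (xs : List V) → ∃[ a ] (C a × All (λ x → Attached x → a ~ x) xs)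
        dominate r∈C [] = _ , r∈C , []
        dominate r∈C (x ∷ xs) with dominate r∈C xs
        ... | a , a∈C , dom with Attached? x
        ...   | no ¬att = a , a∈C , (λ att → contradiction att ¬att) ∷ dom
        ...   | yes att@((c , c∈C , c~x) , _)
                with walk⇒inducedPath (Star.map (λ (adj , w∈C) → adj , inj₁ w∈C) (C-connected a∈C c∈C) ◅◅
                                       (c~x , inj₂ refl) ◅ ε)
        ...     | vs , path , ps with advance att a∈C path ps
        ...       | a′ , a′∈C , keeps , a′~x =
          a′ , a′∈C , (λ _ → a′~x) ∷ All.map (λ f att′ → keeps att′ (f att′)) dom

      dominating-vertex : ∀ {r} → C r → ∃[ a ] (C a × (∀ {x} c d → C c → c ~ x → D d → d ~ x → a ~ x))
      dominating-vertex r∈C with dominate r∈C (allFin n)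
      ... | a , a∈C , dom = a , a∈C , λ {x} c d c∈C c~x d∈D d~x →
        All.lookup dom (∈-allFin x) ((c , c∈C , c~x) , (d , d∈D , d~x))

    -- Decidability of reachability is a parameter here; it is later supplied by the proof that the
    -- algorithm's own `reach` is correct.
    module _ (reachable? : ∀ S {r} → r ∉ S → ∀ v → Dec (ReachableIn G (∁ S) r v)) where

      private
        module Component (S : Subset n) {r} (r∉S : r ∉ S) where

          C : V → Set
          C = ReachableIn G (∁ S) r

          ∉S : ∀ {v} → C v → v ∉ S
          ∉S walk = go (x∉p⇒x∈∁p r∉S) walk
            where
            go : ∀ {u v} → u ∈ ∁ S → ReachableIn G (∁ S) u v → v ∉ S
            go u∈ ε = x∈∁p⇒x∉p u∈
            go u∈ ((_ , w∈ , _) ◅ walk) = go w∈ walk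

          extend : ∀ {u v} → C u → v ∉ S → u ~ v → C v
          extend u∈C v∉S u~v = u∈C ◅◅ (x∉p⇒x∈∁p (∉S u∈C) , x∉p⇒x∈∁p v∉S , u~v) ◅ ε

          connected : ∀ {u v} → C u → C v → Walk C u v
          connected u∈C v∈C = inside u∈C (Star.reverse (λ (p , q , adj) → q , p , ~-sym adj) u∈C ◅◅ v∈C)
            where
            inside : ∀ {u v} → C u → ReachableIn G (∁ S) u v → Walk C u v
            inside u∈C ε = ε
            inside u∈C ((_ , w∈ , adj) ◅ walk) = (adj , w∈C) ◅ inside w∈C walk
              where w∈C = extend u∈C (x∈∁p⇒x∉p w∈) adj

      -- `K` is specified only through its members, so that an intersection of two matrix rows can
      -- be substituted for it.
      commonNeighbours-separator : ∀ {s t S} → IsSeparator G s t S → ∃[ a ] ∃[ b ]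
        (∀ K → CommonNeighbours a b K → IsConnectedSeparator G s t K × K ⊆ S)
      commonNeighbours-separator {s} {t} {S} (s∉S , t∉S , s↮t) = found
        where
        open Component S s∉S renaming (∉S to C⇒∉S; extend to extendC; connected to C-connected)

        C? : ∀ v → Dec (C v)
        C? = reachable? S s∉S

        Boundary : V → Set
        Boundary v = ¬ C v × ∃[ c ] (C c × c ~ v)

        Boundary? : ∀ v → Dec (Boundary v)
        Boundary? v = ¬? (C? v) ×-dec any? (λ c → C? c ×-dec c ~? v)

        N : Subset n
        N = tabulate (λ v → does (Boundary? v))

        ∈N⁻ : ∀ {v} → v ∈ N → Boundary v
        ∈N⁻ {v} v∈N = true-does (Boundary? v) (trans (sym (lookup∘tabulate _ v)) ([]=⇒lookup v∈N))
          where
          true-does : ∀ {P : Set} (P? : Dec P) → does P? ≡ true → P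
          true-does (yes p) _ = p

        ∈N⁺ : ∀ {v} → Boundary v → v ∈ N
        ∈N⁺ {v} bd = lookup⇒[]= v N (trans (lookup∘tabulate _ v) (dec-true (Boundary? v) bd))

        N⊆S : N ⊆ S
        N⊆S {v} v∈N with v ∈? S | ∈N⁻ v∈N
        ... | yes v∈S | _ = v∈S
        ... | no v∉S  | v∉C , c , c∈C , c~v = contradiction (extendC c∈C v∉S c~v) v∉C

        t∉N : t ∉ N
        t∉N t∈N = t∉S (N⊆S t∈N)

        open Component N t∉N renaming (C to D; ∉S to D⇒∉N; extend to extendD; connected to D-connected)

        -- The walk starts at t, outside `C`, and could enter `C` only from a vertex of `N`, which
        -- it avoids.
        D⇒∉C : ∀ {v} → D v → ¬ C v
        D⇒∉C walk = go s↮t walk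
          where
          go : ∀ {u v} → ¬ C u → ReachableIn G (∁ N) u v → ¬ C v
          go u∉C ε = u∉C
          go u∉C ((u∈ , w∈ , adj) ◅ walk) =
            go (λ w∈C → x∈∁p⇒x∉p u∈ (∈N⁺ (u∉C , _ , w∈C , ~-sym adj))) walk

        apart : ∀ {u v} → C u → D v → Far u v
        apart u∈C v∈D = (λ { refl → D⇒∉C v∈D u∈C }) ,
                        (λ u~v → D⇒∉N v∈D (∈N⁺ (D⇒∉C v∈D , _ , u∈C , u~v)))

        apart′ : ∀ {u v} → D u → C v → Far u v
        apart′ u∈D v∈C = (λ { refl → D⇒∉C u∈D v∈C }) , (λ u~v → proj₂ (apart v∈C u∈D) (~-sym u~v))

        D? : ∀ v → Dec (D v)
        D? = reachable? N t∉N

        found : ∃[ a ] ∃[ b ] (∀ K → CommonNeighbours a b K → IsConnectedSeparator G s t K × K ⊆ S)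
        found with dominating-vertex C? D? C-connected D-connected apart ε
                 | dominating-vertex D? C? D-connected C-connected apart′ ε
        ... | a , a∈C , a-dom | b , b∈D , b-dom = a , b , λ K K≡ →
          let
            K⁻ : ∀ {v} → v ∈ K → a ~ v × b ~ v
            K⁻ = Equivalence.to (K≡ _)

            K⇒∉C : ∀ {v} → v ∈ K → ¬ C v
            K⇒∉C v∈K v∈C = proj₂ (apart v∈C b∈D) (~-sym (proj₂ (K⁻ v∈K)))

            K⊆N : ∀ {v} → v ∈ K → v ∈ N
            K⊆N v∈K = ∈N⁺ (K⇒∉C v∈K , a , a∈C , proj₁ (K⁻ v∈K))

            -- Such a vertex has neighbours in both `C` and `D`, so `a` and `b` both dominate it.
            N∩boundaryD⊆K : ∀ {v d} → v ∈ N → D d → d ~ v → v ∈ K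
            N∩boundaryD⊆K v∈N d∈D d~v = let (_ , c , c∈C , c~v) = ∈N⁻ v∈N in
              Equivalence.from (K≡ _) (a-dom c _ c∈C c~v d∈D d~v , b-dom _ c d∈D d~v c∈C c~v)

            -- A step into `D` from outside leaves a vertex of `N`, which by the previous fact lies
            -- in `K`. Since s is outside `D` and t inside, `K` separates them.
            avoidsD : ∀ {u v} → ¬ D u → ReachableIn G (∁ K) u v → ¬ D v
            avoidsD = go K N∩boundaryD⊆K

            clique : InducesConnected G K
            clique u v u∈K v∈K = [ (λ { refl → ε }) , (λ u~v → (u∈K , v∈K , u~v) ◅ ε) ]
              -- Apex `a` and the walk u, b, v: without the edge from u to v, the vertices a, u, b,
              -- v would form an induced 4-cycle.
              (cone-adjacent (proj₁ (K⁻ u∈K)) (proj₁ (K⁻ v∈K))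
                ((~-sym (proj₂ (K⁻ u∈K)) , inj₂ (apart a∈C b∈D)) ◅ (proj₂ (K⁻ v∈K) , inj₁ refl) ◅ ε))
          in (((λ s∈K → K⇒∉C s∈K ε) , (λ t∈K → t∉N (K⊆N t∈K)) ,
               (λ walk → avoidsD (λ s∈D → D⇒∉C s∈D ε) walk ε)) , clique) ,
             (λ v∈K → N⊆S (K⊆N v∈K))
          where
          go : ∀ K → (∀ {v d} → v ∈ N → D d → d ~ v → v ∈ K) →
               ∀ {u v} → ¬ D u → ReachableIn G (∁ K) u v → ¬ D v
          go K ∂D⊆K u∉D ε = u∉D
          go K ∂D⊆K {u} u∉D ((u∈ , w∈ , adj) ◅ walk) = go K ∂D⊆K w∉D walk
            where
            w∉D : ¬ D _
            w∉D w∈D with u ∈? N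
            ... | yes u∈N = x∈∁p⇒x∉p u∈ (∂D⊆K u∈N w∈D (~-sym adj))
            ... | no u∉N  = u∉D (extendD w∈D u∉N (~-sym adj))

-- The algorithm

fold₂ : ∀ {A X Y : Set} {m} → (A → X → Y → A) → A → Vec X m → Vec Y m → A
fold₂ f a []       []       = a
fold₂ f a (x ∷ xs) (y ∷ ys) = fold₂ f (f a x y) xs ys

module _ {A X Y Z : Set} {f : A → X → Y → A × Z} where

  mapAccum-fold₂ : ∀ {g} → (∀ a x y → proj₁ (f a x y) ≡ g a x y) →
                   ∀ {m} a (xs : Vec X m) ys → proj₁ (mapAccum f a xs ys) ≡ fold₂ g a xs ys
  mapAccum-fold₂ f≗g a []       []       = refl
  mapAccum-fold₂ f≗g a (x ∷ xs) (y ∷ ys) rewrite f≗g a x y = mapAccum-fold₂ f≗g _ xs ys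

  mapAccum-zipWith : ∀ {g} → (∀ a x y → proj₂ (f a x y) ≡ g x y) →
                     ∀ {m} a (xs : Vec X m) ys → proj₂ (mapAccum f a xs ys) ≡ zipWith g xs ys
  mapAccum-zipWith f≗g a []       []       = refl
  mapAccum-zipWith f≗g a (x ∷ xs) (y ∷ ys) = cong₂ _∷_ (f≗g a x y) (mapAccum-zipWith f≗g _ xs ys)

module _ {A X Y : Set} {f : A → X → Y → A} (P : A → Set) where

  fold₂-invariant : (∀ {a} x y → P a → P (f a x y)) →
                    ∀ {m a} (xs : Vec X m) ys → P a → P (fold₂ f a xs ys)
  fold₂-invariant pres []       []       pa = pa
  fold₂-invariant pres (x ∷ xs) (y ∷ ys) pa = fold₂-invariant pres xs ys (pres x y pa)

  -- For properties that are never lost again. Nothing is known about the accumulator that arrives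
  -- at position `i`, hence the hypothesis for every `a`.
  fold₂-establish : ∀ {m a} (xs : Vec X m) ys → (∀ {a} x y → P a → P (f a x y)) →
                    ∀ i → (∀ a → P (f a (lookup xs i) (lookup ys i))) → P (fold₂ f a xs ys)
  fold₂-establish (x ∷ xs) (y ∷ ys) pres zero    est = fold₂-invariant pres xs ys (est _)
  fold₂-establish (x ∷ xs) (y ∷ ys) pres (suc i) est = fold₂-establish xs ys pres i est

pattern v0 = var (here refl)
pattern v1 = var (there (here refl))
pattern v2 = var (there (there (here refl)))

module _ {Γ : Ctx} where

  infixr 6 _∪′_
  infixr 7 _∩′_

  -- In a loop body `v0` and `v1` are the entries of the second and first vector and `v2` is the
  -- accumulator. Pointwise operations carry a dummy accumulator; folds emit a dummy output.
  _∪′_ _∩′_ : Tm Γ (vec bool) → Tm Γ (vec bool) → Tm Γ (vec bool)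
  t ∪′ u = snd (loop false′ t u (pair v2 (if′ v1 then true′ else v0)))
  t ∩′ u = snd (loop false′ t u (pair v2 (if′ v1 then v0 else false′)))

  ∁′ full′ : Tm Γ (vec bool) → Tm Γ (vec bool)
  ∁′ t    = snd (loop false′ t t (pair v2 (if′ v1 then false′ else true′)))
  full′ t = snd (loop false′ t t (pair v2 true′))

  -- The language has no indexing; meeting a singleton takes the place of looking up an entry.
  meets : Tm Γ (vec bool) → Tm Γ (vec bool) → Tm Γ bool
  meets t u = fst (loop false′ t u (pair (if′ v1 then (if′ v0 then true′ else v2) else v2) false′))

  -- The matrix only supplies the length.
  singleton : Tm Γ (vec (vec bool)) → Tm Γ nat → Tm Γ (vec bool)
  singleton m t = snd (loop (suc′ t) m m
    (pair (pred′ v2) (if′ positive′ v2 then (if′ positive′ (pred′ v2) then false′ else true′) else false′)))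

  -- Together they compare sizes: counting one set up from zero and the other down leaves a positive
  -- number exactly when the first set is larger.
  count minus : Tm Γ nat → Tm Γ (vec bool) → Tm Γ nat
  count a t = fst (loop a t t (pair (if′ v1 then suc′ v2 else v2) false′))
  minus a t = fst (loop a t t (pair (if′ v1 then pred′ v2 else v2) false′))

shift : ∀ {Γ : Ctx} {τ α β γ} → τ ∈ˡ Γ → Tm (α ∷ β ∷ γ ∷ Γ) τ
shift i = var (there (there (there i)))

module _ {n : ℕ} {Γ : Ctx} (ρ : Env n Γ) where

  ⟦∪′⟧ : ∀ (t u : Tm Γ (vec bool)) → ⟦ t ∪′ u ⟧ ρ ≡ ⟦ t ⟧ ρ ∪ ⟦ u ⟧ ρ
  ⟦∪′⟧ t u = mapAccum-zipWith (λ { _ true _ → refl ; _ false _ → refl }) _ (⟦ t ⟧ ρ) (⟦ u ⟧ ρ)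

  ⟦∩′⟧ : ∀ (t u : Tm Γ (vec bool)) → ⟦ t ∩′ u ⟧ ρ ≡ ⟦ t ⟧ ρ ∩ ⟦ u ⟧ ρ
  ⟦∩′⟧ t u = mapAccum-zipWith (λ { _ true _ → refl ; _ false _ → refl }) _ (⟦ t ⟧ ρ) (⟦ u ⟧ ρ)

  ⟦∁′⟧ : ∀ (t : Tm Γ (vec bool)) → ⟦ ∁′ t ⟧ ρ ≡ ∁ (⟦ t ⟧ ρ)
  ⟦∁′⟧ t = trans (mapAccum-zipWith (λ { _ true _ → refl ; _ false _ → refl }) _ (⟦ t ⟧ ρ) (⟦ t ⟧ ρ))
                 (diagonal (⟦ t ⟧ ρ))
    where
    diagonal : ∀ {m} (p : Subset m) → zipWith (λ x _ → not x) p p ≡ ∁ p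
    diagonal []      = refl
    diagonal (x ∷ p) = cong (not x ∷_) (diagonal p)

  ⟦full′⟧ : ∀ (t : Tm Γ (vec bool)) → ⟦ full′ t ⟧ ρ ≡ ⊤
  ⟦full′⟧ t = trans (mapAccum-zipWith (λ _ _ _ → refl) _ (⟦ t ⟧ ρ) (⟦ t ⟧ ρ)) (diagonal (⟦ t ⟧ ρ))
    where
    diagonal : ∀ {m} (p : Subset m) → zipWith (λ _ _ → true) p p ≡ ⊤
    diagonal []      = refl
    diagonal (x ∷ p) = cong (true ∷_) (diagonal p)

  ⟦meets⟧ : ∀ (t u : Tm Γ (vec bool)) i → ⟦ u ⟧ ρ ≡ ⁅ i ⁆ → ⟦ meets t u ⟧ ρ ≡ lookup (⟦ t ⟧ ρ) i
  ⟦meets⟧ t u i eq rewrite eq = singleton-meets (⟦ t ⟧ ρ) i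
    where
    f : Bool → Bool → Bool → Bool × Bool
    f a x y = ⟦ pair (if′ v1 then (if′ v0 then true′ else v2) else v2) false′ ⟧ (y ∷ x ∷ a ∷ ρ)

    empty-meets : ∀ {m} a (p : Subset m) → proj₁ (mapAccum f a p ⊥) ≡ a
    empty-meets a []          = refl
    empty-meets a (true ∷ p)  = empty-meets a p
    empty-meets a (false ∷ p) = empty-meets a p

    singleton-meets : ∀ {m} (p : Subset m) i → proj₁ (mapAccum f false p ⁅ i ⁆) ≡ lookup p i
    singleton-meets (true ∷ p)  zero    = empty-meets true p
    singleton-meets (false ∷ p) zero    = empty-meets false p
    singleton-meets (true ∷ p)  (suc i) = singleton-meets p i
    singleton-meets (false ∷ p) (suc i) = singleton-meets p i

  -- The counter starts at `suc (toℕ i)`, so it is 1 exactly at index `i` and stays 0 afterwards.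
  -- Starting at `toℕ i` would make the hit indistinguishable from the positions behind it.
  ⟦singleton⟧ : ∀ (m : Tm Γ (vec (vec bool))) t (i : Fin n) → ⟦ t ⟧ ρ ≡ toℕ i → ⟦ singleton m t ⟧ ρ ≡ ⁅ i ⁆
  ⟦singleton⟧ m t i eq rewrite eq = mark (⟦ m ⟧ ρ) i
    where
    f : ℕ → Vec Bool n → Vec Bool n → ℕ × Bool
    f a x y = ⟦ pair (pred′ v2) (if′ positive′ v2 then (if′ positive′ (pred′ v2) then false′ else true′) else false′) ⟧
                (y ∷ x ∷ a ∷ ρ)

    mark-none : ∀ {k} (xs : Vec (Vec Bool n) k) → proj₂ (mapAccum f 0 xs xs) ≡ ⊥
    mark-none []       = refl
    mark-none (x ∷ xs) = cong (false ∷_) (mark-none xs)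

    mark : ∀ {k} (xs : Vec (Vec Bool n) k) i → proj₂ (mapAccum f (suc (toℕ i)) xs xs) ≡ ⁅ i ⁆
    mark (x ∷ xs) zero    = cong (true ∷_) (mark-none xs)
    mark (x ∷ xs) (suc i) = cong (false ∷_) (mark xs i)

  ⟦count⟧ : ∀ (a : Tm Γ nat) (t : Tm Γ (vec bool)) → ⟦ count a t ⟧ ρ ≡ ∣ ⟦ t ⟧ ρ ∣ + ⟦ a ⟧ ρ
  ⟦count⟧ a t = go (⟦ a ⟧ ρ) (⟦ t ⟧ ρ)
    where
    go : ∀ {m} a (p : Subset m) →
         proj₁ (mapAccum (λ a x y → (ifᵇ x then suc a else a) , false) a p p) ≡ ∣ p ∣ + a
    go a []          = refl
    go a (true ∷ p)  = trans (go (suc a) p) (+-suc ∣ p ∣ a)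
    go a (false ∷ p) = go a p

  ⟦minus⟧ : ∀ (a : Tm Γ nat) (t : Tm Γ (vec bool)) → ⟦ minus a t ⟧ ρ ≡ ⟦ a ⟧ ρ ∸ ∣ ⟦ t ⟧ ρ ∣
  ⟦minus⟧ a t = go (⟦ a ⟧ ρ) (⟦ t ⟧ ρ)
    where
    go : ∀ {m} a (p : Subset m) →
         proj₁ (mapAccum (λ a x y → (ifᵇ x then pred a else a) , false) a p p) ≡ a ∸ ∣ p ∣
    go a       []          = refl
    go zero    (true ∷ p)  = trans (go 0 p) (0∸n≡0 ∣ p ∣)
    go (suc a) (true ∷ p)  = go a p
    go a       (false ∷ p) = go a p

-- Reachability in rounds, and the search over all pairs of rows

Matrix : ℕ → Set
Matrix n = Vec (Subset n) n

absorb : ∀ {n} → Subset n → Subset n → Bool → Subset n → Subset n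
absorb S T b row = ifᵇ b then T ∪ (row ∩ ∁ S) else T

-- One breadth-first round: the rows to absorb are chosen by the original `R`, while the accumulated
-- set grows.
expand : ∀ {n} → Matrix n → Subset n → Subset n → Subset n
expand M S R = fold₂ (absorb S) R R M

-- The vector only supplies the number of rounds.
iterateₙ : ∀ {A X : Set} {m} → (A → A) → A → Vec X m → A
iterateₙ f a xs = fold₂ (λ b _ _ → f b) a xs xs

reach : ∀ {n} → Matrix n → Subset n → Subset n → Subset n
reach M R S = iterateₙ (expand M S) R M

expand′ : ∀ {Γ : Ctx} → vec (vec bool) ∈ˡ Γ → vec bool ∈ˡ Γ → vec bool ∈ˡ Γ → Tm Γ (vec bool)
expand′ m s r = fst (loop (var r) (var r) (var m) (pair (if′ v1 then v2 ∪′ (v0 ∩′ ∁′ (shift s)) else v2) false′))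

reach′ : ∀ {Γ : Ctx} → vec (vec bool) ∈ˡ Γ → vec bool ∈ˡ Γ → vec bool ∈ˡ Γ → Tm Γ (vec bool)
reach′ m r s = fst (loop (var r) (var m) (var m)
  (pair (expand′ (there (there (there m))) (there (there (there s))) (there (there (here refl)))) false′))

⟦expand′⟧ : ∀ {n Γ} (ρ : Env n Γ) m s r →
            ⟦ expand′ m s r ⟧ ρ ≡ expand (All.lookup ρ m) (All.lookup ρ s) (All.lookup ρ r)
⟦expand′⟧ {n} {Γ} ρ m s r = mapAccum-fold₂ step _ (All.lookup ρ r) (All.lookup ρ m)
  where
  step : ∀ T b row → ⟦ if′ v1 then v2 ∪′ (v0 ∩′ ∁′ (shift s)) else v2 ⟧ (row ∷ b ∷ T ∷ ρ) ≡
                     absorb (All.lookup ρ s) T b row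
  step T false row = refl
  step T true  row =
    trans (⟦∪′⟧ ρ′ v2 (v0 ∩′ ∁′ (shift s)))
          (cong (T ∪_) (trans (⟦∩′⟧ ρ′ v0 (∁′ (shift s))) (cong (row ∩_) (⟦∁′⟧ ρ′ (shift s)))))
    where
    ρ′ : Env n (vec bool ∷ bool ∷ vec bool ∷ Γ)
    ρ′ = row ∷ true ∷ T ∷ ρ

⟦reach′⟧ : ∀ {n Γ} (ρ : Env n Γ) m r s →
           ⟦ reach′ m r s ⟧ ρ ≡ reach (All.lookup ρ m) (All.lookup ρ r) (All.lookup ρ s)
⟦reach′⟧ ρ m r s = mapAccum-fold₂
  (λ R x y → ⟦expand′⟧ (y ∷ x ∷ R ∷ ρ) (there (there (there m))) (there (there (there s))) (there (there (here refl))))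
  _ (All.lookup ρ m) (All.lookup ρ m)

improve : ∀ {n} → Matrix n → Fin n → Fin n → Subset n → Subset n → Subset n
improve M s t S best =
  ifᵇ lookup S s then best else
  ifᵇ lookup S t then best else
  ifᵇ lookup (reach M ⁅ s ⁆ S) t then best else
  ifᵇ positive (∣ S ∣ ∸ ∣ best ∣) then best else S

-- ⊤ serves as a sentinel: it contains s and t and is larger than every separator.
search : ∀ {n} → Matrix n → Fin n → Fin n → Subset n
search M s t = fold₂ (λ b x _ → fold₂ (λ b x′ _ → improve M s t (x ∩ x′) b) b M M) ⊤ M M

improve′ : ∀ {Γ : Ctx} → vec (vec bool) ∈ˡ Γ → vec bool ∈ˡ Γ → vec bool ∈ˡ Γ →
           vec bool ∈ˡ Γ → vec bool ∈ˡ Γ → Tm Γ (vec bool)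
improve′ m s t S best =
  if′ meets (var S) (var s) then var best else
  if′ meets (var S) (var t) then var best else
  if′ meets (reach′ m s S) (var t) then var best else
  if′ positive′ (minus (count zero′ (var S)) (var best)) then var best else var S

⟦improve′⟧ : ∀ {n Γ} (ρ : Env n Γ) {s t} m s′ t′ S best →
  All.lookup ρ s′ ≡ ⁅ s ⁆ → All.lookup ρ t′ ≡ ⁅ t ⁆ →
  ⟦ improve′ m s′ t′ S best ⟧ ρ ≡ improve (All.lookup ρ m) s t (All.lookup ρ S) (All.lookup ρ best)
⟦improve′⟧ ρ {s} {t} m s′ t′ S best s≡ t≡
  rewrite ⟦meets⟧ ρ (var S) (var s′) s s≡
        | ⟦meets⟧ ρ (var S) (var t′) t t≡
        | ⟦meets⟧ ρ (reach′ m s′ S) (var t′) t t≡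
        | ⟦reach′⟧ ρ m s′ S
        | s≡
        | ⟦minus⟧ ρ (count zero′ (var S)) (var best)
        | ⟦count⟧ ρ zero′ (var S)
        | +-identityʳ ∣ All.lookup ρ S ∣
        = refl

private
  Input : Ty
  Input = vec (vec bool) ⊗ nat ⊗ nat

  -- The innermost variables are ⁅ t ⁆, ⁅ s ⁆ and the matrix.
  Ctx₀ : Ctx
  Ctx₀ = vec bool ∷ vec bool ∷ vec (vec bool) ∷ Input ∷ []

  RowLoop : Ctx → Ctx
  RowLoop Γ = vec bool ∷ vec bool ∷ vec bool ∷ Γ

  #0 : ∀ {τ} {Γ : Ctx} → τ ∈ˡ (τ ∷ Γ)
  #0 = here refl

  #+3 : ∀ {τ Γ} → τ ∈ˡ Γ → τ ∈ˡ RowLoop Γ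
  #+3 i = there (there (there i))

  candidate : Tm (RowLoop (RowLoop Ctx₀)) (vec bool)
  candidate = shift (there #0) ∩′ v1

  PairCtx : Ctx
  PairCtx = vec bool ∷ RowLoop (RowLoop Ctx₀)

  matrixᵛ : vec (vec bool) ∈ˡ PairCtx
  matrixᵛ = there (#+3 (#+3 (there (there #0))))

  sᵛ tᵛ bestᵛ : vec bool ∈ˡ PairCtx
  sᵛ    = there (#+3 (#+3 (there #0)))
  tᵛ    = there (#+3 (#+3 #0))
  bestᵛ = there (there (there #0))

  inner-body : Tm (RowLoop (RowLoop Ctx₀)) (vec bool ⊗ bool)
  inner-body = pair (let′ candidate (improve′ matrixᵛ sᵛ tᵛ #0 bestᵛ)) false′

  outer-body : Tm (RowLoop Ctx₀) (vec bool ⊗ bool)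
  outer-body = pair (fst (loop v2 (shift (there (there #0))) (shift (there (there #0))) inner-body)) false′

search′ : Tm (Input ∷ []) (vec bool)
search′ =
  let′ (fst v0)
    (let′ (singleton v0 (fst (snd v1)))
      (let′ (singleton v1 (snd (snd v2)))
        (fst (loop (full′ v0) v2 v2 outer-body))))

⟦search′⟧ : ∀ {n} (M : Matrix n) s t → ⟦ search′ ⟧ ((M , toℕ s , toℕ t) ∷ []) ≡ search M s t
⟦search′⟧ {n} M s t =
  trans (cong (λ b → proj₁ (mapAccum (λ b x y → ⟦ outer-body ⟧ (y ∷ x ∷ b ∷ ρ)) b M M)) (⟦full′⟧ ρ v0))
        (mapAccum-fold₂ outer≗ ⊤ M M)
  where
  s′ t′ : Subset n
  s′ = ⟦ singleton v0 (fst (snd v1)) ⟧ (M ∷ (M , toℕ s , toℕ t) ∷ [])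
  t′ = ⟦ singleton v1 (snd (snd v2)) ⟧ (s′ ∷ M ∷ (M , toℕ s , toℕ t) ∷ [])

  ρ : Env n Ctx₀
  ρ = t′ ∷ s′ ∷ M ∷ (M , toℕ s , toℕ t) ∷ []

  s′≡ : s′ ≡ ⁅ s ⁆
  s′≡ = ⟦singleton⟧ (M ∷ (M , toℕ s , toℕ t) ∷ []) v0 (fst (snd v1)) s refl

  t′≡ : t′ ≡ ⁅ t ⁆
  t′≡ = ⟦singleton⟧ (s′ ∷ M ∷ (M , toℕ s , toℕ t) ∷ []) v1 (snd (snd v2)) t refl

  module _ (x y b : Subset n) where

    inner≗ : ∀ b′ x′ y′ → proj₁ (⟦ inner-body ⟧ (y′ ∷ x′ ∷ b′ ∷ y ∷ x ∷ b ∷ ρ)) ≡ improve M s t (x ∩ x′) b′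
    inner≗ b′ x′ y′ =
      trans (⟦improve′⟧ (⟦ candidate ⟧ ρ′ ∷ ρ′) matrixᵛ sᵛ tᵛ #0 bestᵛ s′≡ t′≡)
            (cong (λ S → improve M s t S b′) (⟦∩′⟧ ρ′ (shift (there #0)) v1))
      where
      ρ′ : Env n (RowLoop (RowLoop Ctx₀))
      ρ′ = y′ ∷ x′ ∷ b′ ∷ y ∷ x ∷ b ∷ ρ

  outer≗ : ∀ b x y → proj₁ (⟦ outer-body ⟧ (y ∷ x ∷ b ∷ ρ)) ≡
                     fold₂ (λ b x′ _ → improve M s t (x ∩ x′) b) b M M
  outer≗ b x y = mapAccum-fold₂ (inner≗ x y b) b M M

-- Correctness of reachability

iterateₙ-fixpoint : ∀ {A X : Set} {m} {f : A → A} {a} (xs : Vec X m) → f a ≡ a → iterateₙ f a xs ≡ a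
iterateₙ-fixpoint []       fa≡a = refl
iterateₙ-fixpoint (x ∷ xs) fa≡a rewrite fa≡a = iterateₙ-fixpoint xs fa≡a

⊆∧∣q∣≤∣p∣⇒≡ : ∀ {n} {p q : Subset n} → p ⊆ q → ∣ q ∣ ≤ ∣ p ∣ → p ≡ q
⊆∧∣q∣≤∣p∣⇒≡ {p = p} {q} p⊆q ∣q∣≤∣p∣ = ⊆-antisym p⊆q q⊆p
  where
  q⊆p : q ⊆ p
  q⊆p {x} x∈q with x ∈? p
  ... | yes x∈p = x∈p
  ... | no x∉p  = contradiction (p⊂q⇒∣p∣<∣q∣ (p⊆q , x , x∈q , x∉p)) (≤⇒≯ ∣q∣≤∣p∣)

⊆∧≢⇒∣p∣<∣q∣ : ∀ {n} {p q : Subset n} → p ⊆ q → q ≢ p → ∣ p ∣ < ∣ q ∣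
⊆∧≢⇒∣p∣<∣q∣ p⊆q q≢p = ≰⇒> (q≢p ∘ sym ∘ ⊆∧∣q∣≤∣p∣⇒≡ p⊆q)

module _ {n : ℕ} {X : Set} (f : Subset n → Subset n) (inflationary : ∀ R → R ⊆ f R) where

  -- A round that changes nothing makes all later rounds idle; as long as this does not happen,
  -- every round adds a vertex.
  iterateₙ-grows : ∀ {m} R (xs : Vec X m) →
                   f (iterateₙ f R xs) ≡ iterateₙ f R xs ⊎ m + ∣ R ∣ ≤ ∣ iterateₙ f R xs ∣
  iterateₙ-grows R [] = inj₂ ≤-refl
  iterateₙ-grows {suc m} R (x ∷ xs) with ≡-dec _≟ᵇ_ (f R) R | iterateₙ-grows (f R) xs
  ... | yes fR≡R | _ = inj₁ (trans (cong f fixed) (trans fR≡R (sym fixed)))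
    where
    fixed : iterateₙ f (f R) xs ≡ R
    fixed = trans (cong (λ Q → iterateₙ f Q xs) fR≡R) (iterateₙ-fixpoint xs fR≡R)
  ... | no fR≢R | inj₁ fixed  = inj₁ fixed
  ... | no fR≢R | inj₂ growth = inj₂ (≤-trans (≤-reflexive (sym (+-suc m ∣ R ∣)))
                                       (≤-trans (+-monoʳ-≤ m (⊆∧≢⇒∣p∣<∣q∣ (inflationary R) fR≢R)) growth))

  -- Growth in all n rounds from a nonempty set would produce more than n vertices.
  iterateₙ-closes : ∀ R (xs : Vec X n) → 0 < ∣ R ∣ → f (iterateₙ f R xs) ≡ iterateₙ f R xs
  iterateₙ-closes R xs 0<∣R∣ with iterateₙ-grows R xs
  ... | inj₁ fixed  = fixed
  ... | inj₂ growth = contradiction (≤-trans growth (∣p∣≤n (iterateₙ f R xs))) (<⇒≱ (m<m+n n 0<∣R∣))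

module _ {n : ℕ} {S : Subset n} where

  absorb⁺ : ∀ {T b row v} → v ∈ T → v ∈ absorb S T b row
  absorb⁺ {b = true}  v∈T = x∈p∪q⁺ (inj₁ v∈T)
  absorb⁺ {b = false} v∈T = v∈T

  absorb-row⁺ : ∀ {T row v} → v ∈ row → v ∉ S → v ∈ absorb S T true row
  absorb-row⁺ v∈row v∉S = x∈p∪q⁺ (inj₂ (x∈p∩q⁺ (v∈row , x∉p⇒x∈∁p v∉S)))

  absorb-fold⁻ : ∀ {m T v} (bs : Subset m) (rows : Vec (Subset n) m) → v ∈ fold₂ (absorb S) T bs rows →
                 v ∈ T ⊎ (∃[ u ] (u ∈ bs × v ∈ lookup rows u × v ∉ S))
  absorb-fold⁻ [] [] v∈ = inj₁ v∈
  absorb-fold⁻ {T = T} (b ∷ bs) (row ∷ rows) v∈ with absorb-fold⁻ bs rows v∈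
  ... | inj₂ (u , u∈bs , v∈row , v∉S) = inj₂ (suc u , there u∈bs , v∈row , v∉S)
  ... | inj₁ v∈T′ with b
  ...   | false = inj₁ v∈T′
  ...   | true with x∈p∪q⁻ T (row ∩ ∁ S) v∈T′
  ...     | inj₁ v∈T = inj₁ v∈T
  ...     | inj₂ v∈row∖S = let v∈row , v∈∁S = x∈p∩q⁻ row (∁ S) v∈row∖S in
                             inj₂ (zero , here , v∈row , x∈∁p⇒x∉p v∈∁S)

module _ {n : ℕ} (G : Graph n) where

  matrix : Matrix n
  matrix = tabulate λ u → tabulate λ v → adj G u v

  neighbours : Fin n → Subset n
  neighbours = lookup matrix

  ∈neighbours : ∀ {u v} → v ∈ neighbours u ⇔ Adj G u v
  ∈neighbours {u} {v} = mk⇔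
    (λ v∈ → trans (sym entry) ([]=⇒lookup v∈))
    (λ adj → lookup⇒[]= v (neighbours u) (trans entry adj))
    where
    entry : lookup (neighbours u) v ≡ adj G u v
    entry = trans (cong (λ row → lookup row v) (lookup∘tabulate _ u)) (lookup∘tabulate _ v)

  ∈neighbours-∩ : ∀ a b → CommonNeighbours G a b (neighbours a ∩ neighbours b)
  ∈neighbours-∩ a b v = mk⇔
    (λ v∈ → let v∈a , v∈b = x∈p∩q⁻ (neighbours a) (neighbours b) v∈ in
              Equivalence.to ∈neighbours v∈a , Equivalence.to ∈neighbours v∈b)
    (λ (a~v , b~v) → x∈p∩q⁺ (Equivalence.from ∈neighbours a~v , Equivalence.from ∈neighbours b~v))

  expand-inflationary : ∀ S R → R ⊆ expand matrix S R
  expand-inflationary S R {v} = fold₂-invariant (v ∈_) (λ b row → absorb⁺ {S = S} {b = b}) R matrix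

  expand-step : ∀ {S R u v} → u ∈ R → v ∉ S → Adj G u v → v ∈ expand matrix S R
  expand-step {S} {R} {u} {v} u∈R v∉S u~v =
    fold₂-establish (v ∈_) R matrix (λ b row → absorb⁺ {S = S} {b = b}) u
      (λ T → subst (λ b → v ∈ absorb S T b (neighbours u)) (sym ([]=⇒lookup u∈R))
               (absorb-row⁺ {T = T} (Equivalence.from ∈neighbours u~v) v∉S))

  module _ (S : Subset n) {s : Fin n} (s∉S : s ∉ S) where

    private
      Rₛ : Subset n
      Rₛ = reach matrix ⁅ s ⁆ S

    reach-sound : ∀ {v} → v ∈ Rₛ → ReachableIn G (∁ S) s v
    reach-sound v∈ = proj₂ (fold₂-invariant Sound (λ _ _ → expand-sound) matrix matrix start v∈)
      where
      Sound : Subset n → Set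
      Sound R = ∀ {v} → v ∈ R → v ∉ S × ReachableIn G (∁ S) s v

      start : Sound ⁅ s ⁆
      start v∈ with refl ← x∈⁅y⁆⇒x≡y s v∈ = s∉S , ε

      expand-sound : ∀ {R} → Sound R → Sound (expand matrix S R)
      expand-sound {R} sound v∈ with absorb-fold⁻ R matrix v∈
      ... | inj₁ v∈R = sound v∈R
      ... | inj₂ (u , u∈R , v∈row , v∉S) = let u∉S , walk = sound u∈R in
        v∉S , walk ◅◅ (x∉p⇒x∈∁p u∉S , x∉p⇒x∈∁p v∉S , Equivalence.to ∈neighbours v∈row) ◅ ε

    -- `Rₛ` is a fixed point of `expand`, so a walk can be followed edge by edge without comparing
    -- its length to the number of rounds.
    reach-complete : ∀ {v} → ReachableIn G (∁ S) s v → v ∈ Rₛ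
    reach-complete = go s∈
      where
      s∈ : s ∈ Rₛ
      s∈ = fold₂-invariant (s ∈_) (λ {R} _ _ → expand-inflationary S R) matrix matrix (x∈⁅x⁆ s)

      closed : expand matrix S Rₛ ≡ Rₛ
      closed = iterateₙ-closes (expand matrix S) (expand-inflationary S) ⁅ s ⁆ matrix
                 (≤-reflexive (sym (∣⁅x⁆∣≡1 s)))

      go : ∀ {u v} → u ∈ Rₛ → ReachableIn G (∁ S) u v → v ∈ Rₛ
      go u∈ ε = u∈
      go u∈ ((_ , w∈ , u~w) ◅ walk) =
        go (subst (_ ∈_) closed (expand-step u∈ (x∈∁p⇒x∉p w∈) u~w)) walk

    reachable? : ∀ v → Dec (ReachableIn G (∁ S) s v)
    reachable? v = map′ reach-sound reach-complete (v ∈? Rₛ)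

  -- Correctness of the search

  module _ (s t : Fin n) where

    private
      better : Subset n → Subset n → Subset n
      better = improve matrix s t

    -- The case split follows the tests of `improve`. The test for s comes first, because soundness
    -- and completeness of `reach` presuppose that s lies outside `S`.
    improve-cases : ∀ S best →
      (IsSeparator G s t S × ∣ S ∣ ≤ ∣ best ∣ × better S best ≡ S) ⊎
      (better S best ≡ best × (IsSeparator G s t S → ∣ best ∣ ≤ ∣ S ∣))
    improve-cases S best with lookup S s in s∈?
    ... | true = inj₂ (refl , λ (s∉S , _) → contradiction (lookup⇒[]= s S s∈?) s∉S)
    ... | false with lookup S t in t∈?
    ...   | true = inj₂ (refl , λ (_ , t∉S , _) → contradiction (lookup⇒[]= t S t∈?) t∉S)
    ...   | false with lookup (reach matrix ⁅ s ⁆ S) t in r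
    ...     | true = inj₂ (refl , λ (s∉S , _ , s↮t) →
                       contradiction (reach-sound S s∉S (lookup⇒[]= t (reach matrix ⁅ s ⁆ S) r)) s↮t)
    ...     | false with ∣ S ∣ ∸ ∣ best ∣ in excess
    ...       | suc _ = inj₂ (refl , λ _ → <⇒≤ (m∸n≢0⇒n<m (λ eq → contradiction (trans (sym excess) eq) λ ())))
    ...       | zero  = inj₁ ((s∉S , (λ t∈S → absurd t∈? ([]=⇒lookup t∈S)) ,
                               (λ walk → absurd r ([]=⇒lookup (reach-complete S s∉S walk)))) ,
                              m∸n≡0⇒m≤n excess , refl)
      where
      absurd : ∀ {A : Set} {b} → b ≡ false → b ≡ true → A
      absurd refl ()

      s∉S : s ∉ S
      s∉S s∈S = absurd s∈? ([]=⇒lookup s∈S)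

    improve-shrinks : ∀ S best → ∣ better S best ∣ ≤ ∣ best ∣
    improve-shrinks S best with improve-cases S best
    ... | inj₁ (_ , S≤ , eq) = ≤-trans (≤-reflexive (cong ∣_∣ eq)) S≤
    ... | inj₂ (eq , _)      = ≤-reflexive (cong ∣_∣ eq)

    improve-beats : ∀ S best → IsSeparator G s t S → ∣ better S best ∣ ≤ ∣ S ∣
    improve-beats S best sep with improve-cases S best
    ... | inj₁ (_ , _ , eq) = ≤-reflexive (cong ∣_∣ eq)
    ... | inj₂ (eq , best≤) = ≤-trans (≤-reflexive (cong ∣_∣ eq)) (best≤ sep)

    private
      result : Subset n
      result = search matrix s t

    search-sound : result ≡ ⊤ ⊎ IsSeparator G s t result
    search-sound = fold₂-invariant Sound
      (λ x _ → fold₂-invariant Sound (λ {b} x′ _ → improve-sound (x ∩ x′) b) matrix matrix)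
      matrix matrix (inj₁ refl)
      where
      Sound : Subset n → Set
      Sound R = R ≡ ⊤ ⊎ IsSeparator G s t R

      improve-sound : ∀ S b → Sound b → Sound (better S b)
      improve-sound S b sound with improve-cases S b
      ... | inj₁ (sep , _ , eq) = inj₂ (subst (IsSeparator G s t) (sym eq) sep)
      ... | inj₂ (eq , _)       = subst Sound (sym eq) sound

    -- At row `a` of the outer loop and row `b` of the inner one this very candidate is offered;
    -- afterwards the best set never grows.
    search-beats : ∀ a b → IsSeparator G s t (neighbours a ∩ neighbours b) →
                   ∣ result ∣ ≤ ∣ neighbours a ∩ neighbours b ∣
    search-beats a b sep =
      fold₂-establish Small matrix matrix
        (λ x _ → fold₂-invariant Small (λ x′ _ → improve-small (x ∩ x′)) matrix matrix) a
        (λ best → fold₂-establish Small matrix matrix (λ x′ _ → improve-small (neighbours a ∩ x′)) b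
          (λ best′ → improve-beats (neighbours a ∩ neighbours b) best′ sep))
      where
      Small : Subset n → Set
      Small R = ∣ R ∣ ≤ ∣ neighbours a ∩ neighbours b ∣

      improve-small : ∀ S {R} → Small R → Small (better S R)
      improve-small S {R} small = ≤-trans (improve-shrinks S R) small

    module _ (chordal : Chordal G) (s≢t : s ≢ t) (s≁t : ¬ Adj G s t) where

      private
        -- Applied to three separators: the trivial one, to see that the search finds something; the
        -- result, to see that it is connected; and an arbitrary competitor, for minimality.
        clique-below : ∀ {S} → IsSeparator G s t S →
          ∃[ K ] (IsConnectedSeparator G s t K × K ⊆ S × ∣ result ∣ ≤ ∣ K ∣)
        clique-below sep = fromPair (commonNeighbours-separator G chordal reachable? sep)
          where
          fromPair : ∀ {S} →
            (∃[ a ] ∃[ b ] (∀ K → CommonNeighbours G a b K → IsConnectedSeparator G s t K × K ⊆ S)) →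
            ∃[ K ] (IsConnectedSeparator G s t K × K ⊆ S × ∣ result ∣ ≤ ∣ K ∣)
          fromPair (a , b , separates) =
            let K-sep , K⊆S = separates (neighbours a ∩ neighbours b) (∈neighbours-∩ a b)
            in neighbours a ∩ neighbours b , K-sep , K⊆S , search-beats a b (proj₁ K-sep)

        -- Only s and t remain, and they are distinct and not adjacent, so a walk from s cannot
        -- leave s.
        trivial-separator : IsSeparator G s t (∁ (⁅ s ⁆ ∪ ⁅ t ⁆))
        trivial-separator =
          (λ s∈ → x∈∁p⇒x∉p s∈ (x∈p∪q⁺ (inj₁ (x∈⁅x⁆ s)))) ,
          (λ t∈ → x∈∁p⇒x∉p t∈ (x∈p∪q⁺ (inj₂ (x∈⁅x⁆ t)))) ,
          (λ walk → s≢t (sym (stay refl walk)))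
          where
          stay : ∀ {u v} → u ≡ s → ReachableIn G (∁ (∁ (⁅ s ⁆ ∪ ⁅ t ⁆))) u v → v ≡ s
          stay u≡s ε = u≡s
          stay {u} refl ((_ , w∈ , u~w) ◅ walk) with _ ∈? (⁅ s ⁆ ∪ ⁅ t ⁆)
          ... | no w∉ = contradiction (x∉p⇒x∈∁p w∉) (x∈∁p⇒x∉p w∈)
          ... | yes w∈′ with x∈p∪q⁻ ⁅ s ⁆ ⁅ t ⁆ w∈′
          ...   | inj₁ w∈s = stay (x∈⁅y⁆⇒x≡y s w∈s) walk
          ...   | inj₂ w∈t with refl ← x∈⁅y⁆⇒x≡y t w∈t = contradiction u~w s≁t

      search-separates : IsSeparator G s t result
      search-separates with search-sound
      ... | inj₂ sep  = sep
      ... | inj₁ R≡⊤ =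
        -- If the sentinel had survived, `K` would be at least as large as `⊤` and hence contain s.
        let K , ((s∉K , _) , _) , _ , R≤K = clique-below trivial-separator
            K≡⊤ = ⊆∧∣q∣≤∣p∣⇒≡ {p = K} {⊤} (λ _ → ∈⊤) (subst (λ R → ∣ R ∣ ≤ ∣ K ∣) R≡⊤ R≤K)
        in contradiction (subst (s ∈_) (sym K≡⊤) ∈⊤) s∉K

      -- The clique K ⊆ result is no smaller than result, so result is itself that clique.
      search-minimum : IsMinimumConnectedSeparator G s t result
      search-minimum =
        (let K , K-sep , K⊆R , R≤K = clique-below search-separates in
           subst (IsConnectedSeparator G s t) (⊆∧∣q∣≤∣p∣⇒≡ K⊆R R≤K) K-sep) ,
        (λ S′ (sep , _) → let K , _ , K⊆S′ , R≤K = clique-below sep in ≤-trans R≤K (p⊆q⇒∣p∣≤∣q∣ K⊆S′))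

length<size : ∀ {A : Set} {m} (f : A → Tree) (xs : Vec A m) → m < size (encodeVec f xs)
length<size f []       = s≤s z≤n
length<size f (x ∷ xs) = s≤s (≤-trans (length<size f xs) (m≤n+m _ (size (f x))))

mainTheorem9 : PolyTimeSolvable
    {I = ChordalInstance}
    {O = λ i → Subset (ChordalInstance.order i)}
    encodeInstance
    (λ i S → encodeSubset S)
    (λ i S → IsMinimumConnectedSeparator (ChordalInstance.graph i) (ChordalInstance.s i) (ChordalInstance.t i) S)
mainTheorem9 = term-polyTimeSolvable search′ order
  (λ i → matrix (graph i) , toℕ (s i) , toℕ (t i))
  (λ i → search (matrix (graph i)) (s i) (t i))
  -- `Input` is laid out so that its encoding agrees with `encodeInstance` by computation.
  (λ i → refl)
  (λ i → cong encodeSubset (⟦search′⟧ (matrix (graph i)) (s i) (t i)))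
  (λ i → ≤-trans (length<size (encodeVec encodeBool) (matrix (graph i))) (≤-trans (m≤m+n _ _) (n≤1+n _)))
  (λ i → search-minimum (graph i) (s i) (t i) (chordal i) (distinct i) (nonAdjacent i))
  where open ChordalInstance
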